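{- $F_v(2,2,2;J_4)=9$. Moreover, up to isomorphism there are exactly $3$ graphs in $\mathcal{F}_v(2,2,2;J_4;9)$; exactly $1$ of them is maximal $J_4$-free, and exactly $1$ of them is minimal (with respect to the arrowing $(2,2,2)^v$).
   Context: All graphs are finite, simple and undirected. $J_k$ denotes the complete graph $K_k$ with one edge removed. A graph $G$ is $H$-free if it contains no subgraph (not necessarily induced) isomorphic to $H$. For integers $a_1,\dots,a_r\ge 1$, $G\rightarrow(a_1,\dots,a_r)^v$ means that for every coloring of the vertices of $G$ with colors $1,\dots,r$ there is some color $i$ and a clique on $a_i$ vertices all of color $i$. The vertex Folkman number is $F_v(a_1,\dots,a_r;H)=\min\{|V(G)| : G \text{ is } H\text{ -free and } G\rightarrow(a_1,\dots,a_r)^v\}$; $\mathcal{F}_v(a_1,\dots,a_r;H;n)$ is the set of $H$-free graphs on $n$ vertices with $G\rightarrow(a_1,\dots,a_r)^v$. A $J_4$-free graph is maximal $J_4$-free if adding any new edge creates a $J_4$. A graph $G$ with $G\rightarrow(a_1,\dots,a_r)^v$ is minimal if for every edge $e$, $G-e\not\rightarrow(a_1,\dots,a_r)^v$. Note $G\rightarrow(2,2,2)^v$ is equivalent to $\chi(G)\ge 4$. -}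

module Defs where

open import Data.Nat using (ℕ; suc; _<_)
open import Data.Fin using (Fin; zero; suc; _≟_)
open import Data.Bool using (Bool; true; false; _∧_; _∨_; not)
open import Data.Bool.Properties using (∨-comm)
open import Data.Vec using (Vec; lookup; _∷_; [])
open import Data.Product using (Σ; ∃; ∃-syntax; _×_; _,_)
open import Data.Sum using (_⊎_)
open import Data.Empty using (⊥-elim)
open import Relation.Nullary using (¬_; yes; no; does)
open import Relation.Binary.PropositionalEquality using (_≡_; _≢_; refl; cong; cong₂)
open import Function.Bundles using (_↔_; Inverse)
open import Function.Definitions using (Injective)

record Graph (n : ℕ) : Set where
  field
    adj    : Fin n → Fin n → Bool
    sym    : ∀ x y → adj x y ≡ adj y x
    irrefl : ∀ x → adj x x ≡ false
open Graph public

Edge : ∀ {n} → Graph n → Fin n → Fin n → Set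
Edge G x y = adj G x y ≡ true

Contains : ∀ {n m} → Graph n → Graph m → Set
Contains {n} {m} G H =
  Σ (Fin m → Fin n) λ f → Injective _≡_ _≡_ f × (∀ x y → Edge H x y → Edge G (f x) (f y))

Free : ∀ {n m} → Graph m → Graph n → Set
Free H G = ¬ Contains G H

_==_ : ∀ {n} → Fin n → Fin n → Bool
x == y = does (x ≟ y)

isPair : ∀ {n} → Fin n → Fin n → Fin n → Fin n → Bool
isPair i j x y = ((x == i) ∧ (y == j)) ∨ ((x == j) ∧ (y == i))

isPair-sym : ∀ {n} (i j x y : Fin n) → isPair i j x y ≡ isPair i j y x
isPair-sym i j x y with x ≟ i | y ≟ j | x ≟ j | y ≟ i
... | yes _ | yes _ | yes _ | yes _ = refl
... | yes _ | yes _ | yes _ | no _ = refl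
... | yes _ | yes _ | no _ | yes _ = refl
... | yes _ | yes _ | no _ | no _ = refl
... | yes _ | no _ | yes _ | yes _ = refl
... | yes _ | no _ | yes _ | no _ = refl
... | yes _ | no _ | no _ | yes _ = refl
... | yes _ | no _ | no _ | no _ = refl
... | no _ | yes _ | yes _ | yes _ = refl
... | no _ | yes _ | yes _ | no _ = refl
... | no _ | yes _ | no _ | yes _ = refl
... | no _ | yes _ | no _ | no _ = refl
... | no _ | no _ | yes _ | yes _ = refl
... | no _ | no _ | yes _ | no _ = refl
... | no _ | no _ | no _ | yes _ = refl
... | no _ | no _ | no _ | no _ = refl

==-sym : ∀ {n} (x y : Fin n) → (x == y) ≡ (y == x)
==-sym x y with x ≟ y | y ≟ x
... | yes _ | yes _ = refl
... | yes refl | no ¬p = ⊥-elim (¬p refl)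
... | no ¬p | yes refl = ⊥-elim (¬p refl)
... | no _ | no _ = refl

==-refl : ∀ {n} (x : Fin n) → (x == x) ≡ true
==-refl x with x ≟ x
... | yes _ = refl
... | no ¬p = ⊥-elim (¬p refl)

isPair-irrefl : ∀ {n} (i j x : Fin n) → i ≢ j → isPair i j x x ≡ false
isPair-irrefl i j x i≢j with x ≟ i | x ≟ j
... | yes refl | yes refl = ⊥-elim (i≢j refl)
... | yes _ | no _ = refl
... | no _ | yes _ = refl
... | no _ | no _ = refl

addEdge : ∀ {n} (G : Graph n) (i j : Fin n) → i ≢ j → Graph n
addEdge G i j i≢j = record
  { adj    = λ x y → adj G x y ∨ isPair i j x y
  ; sym    = λ x y → cong₂ _∨_ (sym G x y) (isPair-sym i j x y)
  ; irrefl = λ x → cong₂ _∨_ (irrefl G x) (isPair-irrefl i j x i≢j)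
  }

removeEdge : ∀ {n} (G : Graph n) (i j : Fin n) → Graph n
removeEdge G i j = record
  { adj    = λ x y → adj G x y ∧ not (isPair i j x y)
  ; sym    = λ x y → cong₂ _∧_ (sym G x y) (cong not (isPair-sym i j x y))
  ; irrefl = λ x → cong (_∧ not (isPair i j x x)) (irrefl G x)
  }

complete : (k : ℕ) → Graph k
complete k = record
  { adj    = λ x y → not (x == y)
  ; sym    = λ x y → cong not (==-sym x y)
  ; irrefl = λ x → cong not (==-refl x)
  }

J4 : Graph 4
J4 = removeEdge (complete 4) zero (suc zero)

MonoClique : ∀ {n r} → Graph n → (Fin n → Fin r) → Fin r → ℕ → Set
MonoClique {n} G col c k =
  Σ (Fin k → Fin n) λ f → Injective _≡_ _≡_ f
    × (∀ x y → x ≢ y → Edge G (f x) (f y))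
    × (∀ x → col (f x) ≡ c)

Arrows : ∀ {n r} → Graph n → Vec ℕ r → Set
Arrows {n} {r} G as = ∀ (col : Fin n → Fin r) → ∃[ c ] MonoClique G col c (lookup as c)

Iso : ∀ {n m} → Graph n → Graph m → Set
Iso {n} {m} G H = Σ (Fin n ↔ Fin m) λ φ →
  ∀ x y → adj G x y ≡ adj H (Inverse.to φ x) (Inverse.to φ y)

MaximalFree : ∀ {n m} → Graph m → Graph n → Set
MaximalFree H G = Free H G × (∀ i j → (i≢j : i ≢ j) → ¬ Edge G i j → Contains (addEdge G i j i≢j) H)

MinimalArrows : ∀ {n r} → Graph n → Vec ℕ r → Set
MinimalArrows G as = Arrows G as × (∀ i j → Edge G i j → ¬ Arrows (removeEdge G i j) as)

InF : ∀ {n r m} → Vec ℕ r → Graph m → Graph n → Set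
InF as H G = Free H G × Arrows G as

two-two-two : Vec ℕ 3
two-two-two = 2 ∷ 2 ∷ 2 ∷ []

{-# OPTIONS --safe #-}
-- Fix G in 𝓕_v(2,2,2;J4;9) and call a pattern (a set of edges on nine vertices) forcing if every
-- embedding of it in G yields that G is one of three graphs G₁ ⊂ G₂ ⊂ G₃.  J4 is forcing vacuously.
-- Adding an edge to G₃ creates J4, adding one to G₂ creates J4 or a copy of G₃, and adding one to G₁
-- creates J4 or a copy of G₂; hence these three patterns are forcing.  For any other pattern E and any
-- colouring c of its vertices with three colours, G must have an edge ij with c i = c j, so E is
-- forcing as soon as every E + ij with c i = c j contains a copy of a pattern known to be forcing.  A
-- finite chain of such deductions, found by computer search, ends with the empty pattern.
--
-- Fewer than nine vertices are excluded by adding isolated vertices, since G₁, G₂, G₃ have none.  G₃ is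
-- the only maximal and G₁ the only minimal graph of the three, which also tells them apart.
module Submission where

open import Defs
open import Data.Bool using (true; false; _∧_; _∨_; not)
import Data.Bool.Properties as Bool
open import Data.Empty using (⊥)
open import Data.Fin using (Fin; zero; suc; _≟_; _↑ˡ_; punchOut; #_)
  renaming (_<_ to _<ᶠ_; _<?_ to _<ᶠ?_)
open import Data.Fin.Properties
  using (all?; any?; <-cmp; punchOut-injective; injective⇒≤; suc-injective; ↑ˡ-injective)
open import Data.List using (List; []; _∷_; _++_; map; filter; allFin; cartesianProduct)
open import Data.List.Membership.Propositional using (_∈_; find; lose)
open import Data.List.Membership.Propositional.Properties
  using (∈-filter⁺; ∈-cartesianProduct⁺; ∈-allFin)
import Data.List.Membership.DecPropositional as DecMembership
open import Data.List.Relation.Binary.Pointwise using (Pointwise; []; _∷_)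
  renaming (decidable to pointwise?)
open import Data.List.Relation.Unary.All as All using (All; []; _∷_)
open import Data.List.Relation.Unary.Any as Any using (Any; here; there)
open import Data.Nat using (ℕ; zero; suc; _<_; NonZero; _/_; _%_; s≤s⁻¹; _≤′_; ≤′-refl; ≤′-step)
import Data.Nat.Properties as ℕ
open import Data.Nat.DivMod using (_mod_)
open import Data.Product using (Σ; ∃; ∃-syntax; _×_; _,_; proj₁; proj₂; uncurry)
open import Data.Product.Properties using (≡-dec)
open import Data.Sum as Sum using (_⊎_; inj₁; inj₂; [_,_]′)
open import Data.Unit using (tt)
open import Data.Vec using (Vec; []; _∷_; _∷ʳ_; lookup)
open import Data.Vec.Relation.Unary.AllPairs using (allPairs?)
open import Data.Vec.Relation.Unary.Unique.Propositional using (Unique)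
open import Data.Vec.Relation.Unary.Unique.Propositional.Properties using (lookup-injective)
open import Function using (_∘_; id; case_of_)
open import Function.Bundles using (_↔_; Inverse; mk↔ₛ′; mk⇔)
open import Function.Definitions using (Injective)
open import Function.Properties.Inverse using (↔-sym; ↔-trans)
open import Relation.Binary.Definitions using (Tri; tri<; tri≈; tri>)
open import Relation.Binary.PropositionalEquality
  using (_≡_; _≢_; refl; trans; cong; cong₂; subst; subst₂) renaming (sym to ≡-sym)
open import Relation.Nullary using (¬_; Dec; yes; no; does; contradiction)
open import Relation.Nullary.Decidable
  using (toWitness; from-yes; ¬?; _×-dec_; _⊎-dec_; _→-dec_; dec-true; dec-false; does-⇔; map′)

-- Listing the nine-vertex graphs up to isomorphism would be far too much for a type checker. Two
-- choices avoid it. Patterns are ordinary, not induced, subgraphs, so one forcing pattern disposes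
-- of all graphs that contain it; and every containment in the chain comes with an explicit
-- permutation, so that checking the chain involves no search for isomorphisms. All patterns live on
-- the full nine vertices, `J4` being padded with isolated ones. An embedding into `G` is then a
-- bijection: a colouring of the pattern is a colouring of `G`, and a copy of a pattern outside
-- which `G` has no edge is an isomorphism. The chain pushes the maximum degree down: the stars with
-- 8, 7, and so on down to 1 edges are shown to be forcing in this order, each by way of denser
-- patterns that contain such a star.

private variable
  k m n r : ℕ

-- Bijections, isomorphisms and containment

injection-inverse : {f : Fin n → Fin n} → Injective _≡_ _≡_ f → ∀ y → ∃[ x ] f x ≡ y
injection-inverse {suc n} {f} f-inj y with any? (λ x → f x ≟ y)
... | yes found  = found
-- Pigeonhole: punching out a missed value would leave an injection into a smaller set.
... | no missing = contradiction (injective⇒≤ squeezed-injective) (ℕ.<⇒≱ (ℕ.n<1+n n))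
  where
  avoided : ∀ x → y ≢ f x
  avoided x y≡fx = missing (x , ≡-sym y≡fx)

  squeezed : Fin (suc n) → Fin n
  squeezed x = punchOut (avoided x)

  squeezed-injective : Injective _≡_ _≡_ squeezed
  squeezed-injective {x} {x′} = f-inj ∘ punchOut-injective (avoided x) (avoided x′)

Iso-sym : {G : Graph n} {H : Graph m} → Iso G H → Iso H G
Iso-sym {G = G} {H} (φ , eq) = ↔-sym φ , λ x y →
  trans (≡-sym (cong₂ (adj H) (Inverse.strictlyInverseˡ φ x) (Inverse.strictlyInverseˡ φ y)))
        (≡-sym (eq (Inverse.from φ x) (Inverse.from φ y)))

Iso-trans : {G : Graph n} {H : Graph m} {K : Graph k} → Iso G H → Iso H K → Iso G K
Iso-trans (φ , eqφ) (ψ , eqψ) = ↔-trans φ ψ , λ x y →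
  trans (eqφ x y) (eqψ (Inverse.to φ x) (Inverse.to φ y))

injective⇒Iso : {G H : Graph n} {f : Fin n → Fin n} → Injective _≡_ _≡_ f →
  (∀ x y → adj G x y ≡ adj H (f x) (f y)) → Iso G H
injective⇒Iso {f = f} f-inj eq =
  mk↔ₛ′ f (proj₁ ∘ f⁻¹) (proj₂ ∘ f⁻¹) (λ x → f-inj (proj₂ (f⁻¹ (f x)))) , eq
  where f⁻¹ = injection-inverse f-inj

Contains-trans : {G : Graph n} {H : Graph m} {K : Graph k} →
  Contains G H → Contains H K → Contains G K
Contains-trans (f , f-inj , f-hom) (g , g-inj , g-hom) =
  f ∘ g , g-inj ∘ f-inj , λ x y xy → f-hom (g x) (g y) (g-hom x y xy)

_⊆ᴳ_ : Graph n → Graph n → Set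
G ⊆ᴳ H = ∀ x y → Edge G x y → Edge H x y

_⊆ᴳ?_ : (G H : Graph n) → Dec (G ⊆ᴳ H)
G ⊆ᴳ? H = all? λ x → all? λ y → (adj G x y Bool.≟ true) →-dec (adj H x y Bool.≟ true)

⊆ᴳ⇒Contains : {G H : Graph n} → G ⊆ᴳ H → Contains H G
⊆ᴳ⇒Contains G⊆H = id , id , G⊆H

Edge-sym : (G : Graph n) → ∀ {x y} → Edge G x y → Edge G y x
Edge-sym G {x} {y} = trans (sym G y x)

Edge⇒≢ : (G : Graph n) → ∀ {x y} → Edge G x y → x ≢ y
Edge⇒≢ G {x} xy refl = case trans (≡-sym xy) (irrefl G x) of λ ()

-- Arrowing in terms of monochromatic edges

MonoEdge : Graph n → (Fin n → Fin r) → Set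
MonoEdge G col = ∃[ x ] ∃[ y ] Edge G x y × col x ≡ col y

Arrows⇒MonoEdge : (G : Graph n) → Arrows G two-two-two → ∀ col → MonoEdge G col
Arrows⇒MonoEdge G arrows col with arrows col
-- The colours are split because `lookup two-two-two c` reduces to 2 only for a concrete `c`.
... | zero , f , _ , clique , mono =
  f zero , f (suc zero) , clique zero (suc zero) (λ ()) , trans (mono zero) (≡-sym (mono (suc zero)))
... | suc zero , f , _ , clique , mono =
  f zero , f (suc zero) , clique zero (suc zero) (λ ()) , trans (mono zero) (≡-sym (mono (suc zero)))
... | suc (suc zero) , f , _ , clique , mono =
  f zero , f (suc zero) , clique zero (suc zero) (λ ()) , trans (mono zero) (≡-sym (mono (suc zero)))

MonoEdge⇒Arrows : (G : Graph n) → (∀ col → MonoEdge G col) → Arrows G two-two-two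
MonoEdge⇒Arrows {n} G mono col with mono col
... | x , y , xy , same = col x , subst (MonoClique G col (col x)) (≡-sym (size (col x))) clique
  where
  size : ∀ c → lookup two-two-two c ≡ 2
  size zero             = refl
  size (suc zero)       = refl
  size (suc (suc zero)) = refl

  ends : Fin 2 → Fin n
  ends zero       = x
  ends (suc zero) = y

  clique : MonoClique G col (col x) 2
  clique = ends
    , (λ { {zero} {zero} _ → refl
         ; {zero} {suc zero} x≡y → contradiction x≡y (Edge⇒≢ G xy)
         ; {suc zero} {zero} y≡x → contradiction (≡-sym y≡x) (Edge⇒≢ G xy)
         ; {suc zero} {suc zero} _ → refl })
    , (λ { zero zero 0≢0 → contradiction refl 0≢0
         ; zero (suc zero) _ → xy
         ; (suc zero) zero _ → Edge-sym G xy
         ; (suc zero) (suc zero) 1≢1 → contradiction refl 1≢1 })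
    , (λ { zero → refl ; (suc zero) → ≡-sym same })

-- A colouring of the larger graph is pulled back along the embedding, and the monochromatic edge
-- found there is pushed forward.
Arrows-mono : {G : Graph n} {H : Graph m} → Contains H G → Arrows G two-two-two → Arrows H two-two-two
Arrows-mono {G = G} {H} (f , _ , f-hom) arrows = MonoEdge⇒Arrows H λ col →
  case Arrows⇒MonoEdge G arrows (col ∘ f) of λ (x , y , xy , same) → f x , f y , f-hom x y xy , same

-- Invariance of maximality and minimality under isomorphism

Inverse-injective : ∀ {A B : Set} (φ : A ↔ B) → Injective _≡_ _≡_ (Inverse.to φ)
Inverse-injective φ {x} {y} eq =
  trans (≡-sym (Inverse.strictlyInverseʳ φ x))
        (trans (cong (Inverse.from φ) eq) (Inverse.strictlyInverseʳ φ y))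

Iso⇒Contains : {G : Graph n} {H : Graph m} → Iso G H → Contains H G
Iso⇒Contains (φ , eq) = Inverse.to φ , Inverse-injective φ , λ x y xy → trans (≡-sym (eq x y)) xy

==-map : {f : Fin n → Fin m} → Injective _≡_ _≡_ f → ∀ x y → (x == y) ≡ (f x == f y)
==-map {f = f} f-inj x y = does-⇔ (mk⇔ (cong f) f-inj) (x ≟ y) (f x ≟ f y)

-- Lets an isomorphism carry over to the two graphs with corresponding edges added or removed.
isPair-map : {f : Fin n → Fin m} → Injective _≡_ _≡_ f →
  ∀ i j x y → isPair i j x y ≡ isPair (f i) (f j) (f x) (f y)
isPair-map f-inj i j x y =
  cong₂ _∨_ (cong₂ _∧_ (==-map f-inj x i) (==-map f-inj y j))
            (cong₂ _∧_ (==-map f-inj x j) (==-map f-inj y i))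

isPair-self : ∀ (i j : Fin n) → isPair i j i j ≡ true
isPair-self i j rewrite ==-refl i | ==-refl j = refl

MaximalFree-Iso : {G : Graph n} {H : Graph m} {K : Graph k} → Iso G H → MaximalFree K H → MaximalFree K G
MaximalFree-Iso {G = G} {H} {K} (φ , eq) (free , saturated) =
  (λ c → free (Contains-trans {G = H} {G} {K} (Iso⇒Contains {G = G} {H} (φ , eq)) c)) ,
  λ i j i≢j ¬ij →
    let +ij = addEdge G i j i≢j
        +φij = addEdge H (Inverse.to φ i) (Inverse.to φ j) (i≢j ∘ Inverse-injective φ)
        ext : Iso +ij +φij
        ext = φ , λ x y → cong₂ _∨_ (eq x y) (isPair-map (Inverse-injective φ) i j x y)
    in Contains-trans {G = +ij} {+φij} {K} (Iso⇒Contains {G = +φij} {+ij} (Iso-sym {G = +ij} {+φij} ext))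
         (saturated _ _ (i≢j ∘ Inverse-injective φ) (¬ij ∘ trans (eq i j)))

MinimalArrows-Iso : {G : Graph n} {H : Graph m} → Iso G H →
  MinimalArrows H two-two-two → MinimalArrows G two-two-two
MinimalArrows-Iso {G = G} {H} (φ , eq) (arrows , critical) =
  Arrows-mono {G = H} {G} (Iso⇒Contains {G = H} {G} (Iso-sym {G = G} {H} (φ , eq))) arrows ,
  λ i j ij −φij-arrows →
    let −ij  = removeEdge G i j
        −φij = removeEdge H (Inverse.to φ i) (Inverse.to φ j)
        res : Iso −ij −φij
        res = φ , λ x y → cong₂ _∧_ (eq x y) (cong not (isPair-map (Inverse-injective φ) i j x y))
    in critical _ _ (trans (≡-sym (eq i j)) ij)
         (Arrows-mono {G = −ij} {−φij} (Iso⇒Contains {G = −ij} {−φij} res) −φij-arrows)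

-- Decidable criteria for freeness and for arrowing

-- No edge lies in two triangles, which is `J4`-freeness. The edge conditions stand between the
-- quantifiers so that the decision procedure drops non-edges early instead of running through all
-- maps from `Fin 4`.
DiamondFree : Graph n → Set
DiamondFree G = ∀ c d → Edge G c d →
  ∀ a → Edge G a c → Edge G a d → ∀ b → Edge G b c → Edge G b d → a ≡ b

diamondFree? : (G : Graph n) → Dec (DiamondFree G)
diamondFree? G = all? λ c → all? λ d → edge? c d →-dec all? λ a → edge? a c →-dec edge? a d →-dec
    all? λ b → edge? b c →-dec edge? b d →-dec a ≟ b
  where
  edge? : ∀ x y → Dec (Edge G x y)
  edge? x y = adj G x y Bool.≟ true

DiamondFree⇒Free-J4 : {G : Graph n} → DiamondFree G → Free J4 G
DiamondFree⇒Free-J4 free (f , f-inj , f-hom) =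
  -- In `J4` the vertices 2 and 3 span the edge shared by the two triangles; 0 and 1 are the apexes,
  -- which would have to coincide.
  case f-inj (free (f (# 2)) (f (# 3)) (f-hom _ _ refl)
    (f (# 0)) (f-hom _ _ refl) (f-hom _ _ refl) (f (# 1)) (f-hom _ _ refl) (f-hom _ _ refl)) of λ ()

Free-mono : {G : Graph n} {H : Graph m} {K : Graph k} → Contains H G → Free K H → Free K G
Free-mono {G = G} {H} {K} H⊇G free G⊇K = free (Contains-trans {G = H} {G} {K} H⊇G G⊇K)

-- No colouring of vs, vertex by vertex, extends the partial colouring properly.
Uncolourable : Graph n → List (Fin n × Fin r) → List (Fin n) → Set
Uncolourable         G assigned []       = ⊥
Uncolourable {r = r} G assigned (v ∷ vs) = ∀ (c : Fin r) →
  Any (λ (u , d) → Edge G u v × d ≡ c) assigned ⊎ Uncolourable G ((v , c) ∷ assigned) vs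

uncolourable? : (G : Graph n) (assigned : List (Fin n × Fin r)) (vs : List (Fin n)) →
  Dec (Uncolourable G assigned vs)
uncolourable? G assigned []       = no λ ()
uncolourable? G assigned (v ∷ vs) = all? λ c →
  Any.any? (λ (u , d) → (adj G u v Bool.≟ true) ×-dec (d ≟ c)) assigned
    ⊎-dec uncolourable? G ((v , c) ∷ assigned) vs

-- The branch of the search tree that agrees with `col` must end in a clash, since no branch
-- survives to the empty list.
Uncolourable⇒MonoEdge : (G : Graph n) (col : Fin n → Fin r) →
  (assigned : List (Fin n × Fin r)) (vs : List (Fin n)) →
  All (λ (u , d) → col u ≡ d) assigned → Uncolourable G assigned vs → MonoEdge G col
Uncolourable⇒MonoEdge G col assigned (v ∷ vs) agree uncolourable with uncolourable (col v)
... | inj₁ clash =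
  let (u , d) , ud∈ , uv , d≡ = find clash in u , v , uv , trans (All.lookup agree ud∈) d≡
... | inj₂ rest  = Uncolourable⇒MonoEdge G col _ vs (refl ∷ agree) rest

-- Patterns and machine-checkable certificates

-- Only edges that must be present are recorded, nothing about non-edges. The orientation of a
-- listed pair is immaterial, which `Joins` takes care of.
Pattern : ℕ → Set
Pattern n = List (Fin n × Fin n)

Joins : Pattern n → Fin n → Fin n → Set
Joins E x y = (x , y) ∈ E ⊎ (y , x) ∈ E

joins? : (E : Pattern n) → ∀ x y → Dec (Joins E x y)
joins? E x y = ((x , y) ∈? E) ⊎-dec ((y , x) ∈? E)
  where open DecMembership (≡-dec _≟_ _≟_)

Loopless : Pattern n → Set
Loopless = All λ (x , y) → x ≢ y

graph : (E : Pattern n) → Loopless E → Graph n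
graph E loopless = record
  { adj    = λ x y → does (joins? E x y)
  ; sym    = λ x y → does-⇔ (mk⇔ Sum.swap Sum.swap) (joins? E x y) (joins? E y x)
  ; irrefl = λ x → dec-false (joins? E x x)
      [ (λ xx → All.lookup loopless xx refl) , (λ xx → All.lookup loopless xx refl) ]′
  }

decided : {A : Set} (a? : Dec A) → does a? ≡ true → A
decided (yes a) _ = a

Edge⇒Joins : (E : Pattern n) (loopless : Loopless E) →
  ∀ {x y} → Edge (graph E loopless) x y → Joins E x y
Edge⇒Joins E _ {x} {y} = decided (joins? E x y)

record Embedding (E : Pattern n) (G : Graph m) : Set where
  field
    place     : Fin n → Fin m
    injective : Injective _≡_ _≡_ place
    edges     : All (λ (x , y) → Edge G (place x) (place y)) E

  joined : ∀ {x y} → Joins E x y → Edge G (place x) (place y)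
  joined (inj₁ xy) = All.lookup edges xy
  joined (inj₂ yx) = Edge-sym G (All.lookup edges yx)
open Embedding

insertEdge : {E : Pattern n} {G : Graph m} (f : Embedding E G) → ∀ {x y} → Edge G (place f x) (place f y) →
  Embedding ((x , y) ∷ E) G
insertEdge f xy = record { place = place f ; injective = injective f ; edges = xy ∷ edges f }

-- A vector rather than a function, so that `π` can be read off a numeral and its injectivity
-- decided.
record Sends (π : Vec (Fin n) n) (E F : Pattern n) : Set where
  constructor sends
  field
    unique : Unique π
    joins  : All (λ (x , y) → Joins F (lookup π x) (lookup π y)) E

sends? : (π : Vec (Fin n) n) (E F : Pattern n) → Dec (Sends π E F)
sends? π E F = map′ (uncurry sends) (λ (sends u j) → u , j)
  (allPairs? (λ x y → ¬? (x ≟ y)) π ×-dec All.all? (λ (x , y) → joins? F (lookup π x) (lookup π y)) E)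

-- This makes forcing upward closed: a copy of the richer pattern `F` contains one of `E`, so
-- whatever `E` forces, `F` forces too.
pull : {π : Vec (Fin n) n} {E F : Pattern n} {G : Graph m} → Sends π E F → Embedding F G → Embedding E G
pull {π = π} (sends unique joins) f = record
  { place     = place f ∘ lookup π
  ; injective = lookup-injective unique _ _ ∘ injective f
  ; edges     = All.map (joined f) joins
  }

-- A hint (k , π) claims that π maps the pattern at position k of a list into the pattern at hand.
Hint : ℕ → Set
Hint n = ℕ × Vec (Fin n) n

Hit : List (Pattern n) → Hint n → Pattern n → Set
Hit []       _           F = ⊥
Hit (E ∷ Es) (zero  , π) F = Sends π E F
Hit (E ∷ Es) (suc k , π) F = Hit Es (k , π) F

hit? : (Es : List (Pattern n)) (h : Hint n) (F : Pattern n) → Dec (Hit Es h F)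
hit? []       _           F = no λ ()
hit? (E ∷ Es) (zero  , π) F = sends? π E F
hit? (E ∷ Es) (suc k , π) F = hit? Es (k , π) F

-- Each unordered pair occurs once, in lexicographic order, so that a list of hints can be matched
-- with it position by position.
pairs : ∀ n → Pattern n
pairs n = filter (uncurry _<ᶠ?_) (cartesianProduct (allFin n) (allFin n))

∈-pairs : {x y : Fin n} → x <ᶠ y → (x , y) ∈ pairs n
∈-pairs = ∈-filter⁺ (uncurry _<ᶠ?_) (∈-cartesianProduct⁺ (∈-allFin _) (∈-allFin _))

mono? : (c : Vec (Fin r) n) (p : Fin n × Fin n) → Dec (lookup c (proj₁ p) ≡ lookup c (proj₂ p))
mono? c (x , y) = lookup c x ≟ lookup c y

monoPairs : Vec (Fin r) n → Pattern n
monoPairs {n = n} c = filter (mono? c) (pairs n)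

nonEdges : Pattern n → Pattern n
nonEdges {n} E = filter (λ (x , y) → ¬? (joins? E x y)) (pairs n)

∈-nonEdges : (E : Pattern n) → ∀ {x y} → x <ᶠ y → ¬ Joins E x y → (x , y) ∈ nonEdges E
∈-nonEdges E x<y ¬xy = ∈-filter⁺ (λ (x , y) → ¬? (joins? E x y)) (∈-pairs x<y) ¬xy

-- One certificate format for both kinds of deduction: with `nonEdges E` it says that every proper
-- extension of `E` is already settled, with `monoPairs c` that every edge violating the colouring
-- `c` is.
Covered : List (Pattern n) → Pattern n → Pattern n → List (Hint n) → Set
Covered Es E = Pointwise λ p h → Hit Es h (p ∷ E)

covered? : (Es : List (Pattern n)) (E : Pattern n) (ps : Pattern n) (hs : List (Hint n)) →
  Dec (Covered Es E ps hs)
covered? Es E = pointwise? λ p h → hit? Es h (p ∷ E)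

covered-lookup : {Es : List (Pattern n)} {E ps : Pattern n} {hs : List (Hint n)} →
  Covered Es E ps hs → ∀ {p} → p ∈ ps → ∃[ h ] Hit Es h (p ∷ E)
covered-lookup (hit ∷ _)    (here refl) = _ , hit
covered-lookup {Es = Es} (_ ∷ covered) (there p∈) = covered-lookup {Es = Es} covered p∈

-- A lemma claims that its pattern is forcing because of its colouring.
Lemma : ℕ → Set
Lemma n = Pattern n × Vec (Fin 3) n × List (Hint n)

-- A pattern is pushed onto the list once it is settled, so position 0 of a hint always means the
-- latest one. The chain has to end with the empty pattern because that one embeds in every graph.
Valid : List (Pattern n) → List (Lemma n) → Set
Valid Es       ((E , c , hs) ∷ ls) = Covered Es E (monoPairs c) hs × Valid (E ∷ Es) ls
Valid []       []                  = ⊥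
Valid (E ∷ _)  []                  = E ≡ []

valid? : (Es : List (Pattern n)) (ls : List (Lemma n)) → Dec (Valid Es ls)
valid? Es            ((E , c , hs) ∷ ls) = covered? Es E (monoPairs c) hs ×-dec valid? (E ∷ Es) ls
valid? []            []                  = no λ ()
valid? ([] ∷ _)      []                  = yes refl
valid? ((_ ∷ _) ∷ _) []                  = no λ ()

-- Soundness of the certificates

-- `Goal` is left open because the certificates are used twice: for the classification, and with a
-- copy of `J4` as the goal for the maximality of `G₃`.
module Consequences (G : Graph n) (Goal : Set) where

  Forces : Pattern n → Set
  Forces E = Embedding E G → Goal

  hit⇒Forces : ∀ {Es} → All Forces Es → ∀ h {F} → Hit Es h F → Forces F
  hit⇒Forces (force ∷ _)  (zero  , π) hit f = force (pull hit f)
  hit⇒Forces (_ ∷ forces) (suc k , π) hit f = hit⇒Forces forces (k , π) hit f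

  covered⇒goal : ∀ {Es E ps hs} → All Forces Es → Covered Es E ps hs → (f : Embedding E G) →
    ∀ {x y} → (x , y) ∈ ps → Edge G (place f x) (place f y) → Goal
  covered⇒goal {Es} forces covered f xy∈ xy =
    let h , hit = covered-lookup {Es = Es} covered xy∈ in hit⇒Forces forces h hit (insertEdge f xy)

  -- Pattern and graph have equally many vertices, so `f` is a bijection and transports `c` to `G`.
  -- The monochromatic edge that results comes from a pair in `monoPairs c`, and inserting this pair
  -- gives a settled pattern.
  colour-step : (∀ col → MonoEdge {r = 3} G col) → ∀ {Es E c hs} → All Forces Es →
    Covered Es E (monoPairs c) hs → Forces E
  colour-step mono {E = E} {c} forces covered f
    with mono (lookup c ∘ proj₁ ∘ injection-inverse (injective f))
  ... | u , v , uv , same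
    -- These are the preimages through which the colouring of `G` was defined; splitting on them
    -- turns `same` into an equality of the colours of `x` and `y`.
    with injection-inverse (injective f) u | injection-inverse (injective f) v
  ... | x , refl | y , refl with <-cmp x y
  ... | tri< x<y _ _ =
    covered⇒goal {E = E} forces covered f (∈-filter⁺ (mono? c) (∈-pairs x<y) same) uv
  ... | tri> _ _ y<x =
    covered⇒goal {E = E} forces covered f (∈-filter⁺ (mono? c) (∈-pairs y<x) (≡-sym same))
      (Edge-sym G uv)
  ... | tri≈ _ refl _ = contradiction refl (Edge⇒≢ G uv)

  valid⇒goal : (∀ col → MonoEdge {r = 3} G col) → ∀ {Es} → All Forces Es →
    ∀ ls → Valid Es ls → Goal
  valid⇒goal mono forces ((E , c , hs) ∷ ls) (covered , valid) =
    valid⇒goal mono (colour-step mono {c = c} forces covered ∷ forces) ls valid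
  valid⇒goal mono (force ∷ _) [] refl =
    force (record { place = id ; injective = id ; edges = [] })

  -- Either `G` has an edge outside the copy of `E`, and the certificate applies to it, or the copy
  -- is all of `G` and the bijection `f` is an isomorphism.
  exact-step : ∀ {Es E hs} (loopless : Loopless E) → All Forces Es → Covered Es E (nonEdges E) hs →
    (Iso G (graph E loopless) → Goal) → Forces E
  exact-step {Es} {E} loopless forces covered iso⇒goal f
    with Any.any? (λ (x , y) → adj G (place f x) (place f y) Bool.≟ true) (nonEdges E)
  ... | yes some = let _ , xy∈ , xy = find some in covered⇒goal {Es} forces covered f xy∈ xy
  ... | no none = iso⇒goal (Iso-sym {G = graph E loopless} {G}
      (injective⇒Iso {G = graph E loopless} {G} (injective f)
        λ x y → agrees x y (joins? E x y) refl))
    where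
    absent : ∀ {x y} → x <ᶠ y → ¬ Joins E x y → ¬ Edge G (place f x) (place f y)
    absent x<y ¬xy xy = none (lose (∈-nonEdges E x<y ¬xy) xy)

    -- The adjacency in `G` is generalised to `b`, so that it can be split while the equation for it
    -- stays available.
    agrees : ∀ {b} x y (xy? : Dec (Joins E x y)) → adj G (place f x) (place f y) ≡ b → does xy? ≡ b
    agrees         x y (yes xy) eq = trans (≡-sym (joined f xy)) eq
    agrees {false} x y (no ¬xy) eq = refl
    agrees {true}  x y (no ¬xy) eq with <-cmp x y
    ... | tri< x<y _ _  = contradiction eq (absent x<y ¬xy)
    ... | tri> _ _ y<x  = contradiction (Edge-sym G eq) (absent y<x (¬xy ∘ Sum.swap))
    ... | tri≈ _ refl _ = contradiction refl (Edge⇒≢ G eq)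

-- The three graphs

-- The fixed length `k` restores the leading zeros that a numeral loses. The digits are decimal;
-- reducing modulo `m` serves to land in `Fin m`.
digits : ∀ m .{{_ : NonZero m}} k → ℕ → Vec (Fin m) k
digits m zero    a = []
digits m (suc k) a = digits m k (a / 10) ∷ʳ ((a % 10) mod m)

-- The two-digit numeral xy stands for the edge between x and y.
pattern₉ : List ℕ → Pattern 9
pattern₉ = map λ a → (a / 10) mod 9 , (a % 10) mod 9

-- In `G₁` the vertices 0, 1, 2, 3 have degree 3 and the other five have degree 4. The added edges
-- 02 and 13 complete 01 and 23 to the 4-cycle 0, 1, 3, 2, so `G₃` is 4-regular.
J4-edges G₁-edges G₂-edges G₃-edges : Pattern 9
J4-edges = pattern₉ (02 ∷ 03 ∷ 12 ∷ 13 ∷ 23 ∷ [])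
G₁-edges = pattern₉
  (01 ∷ 04 ∷ 05 ∷ 16 ∷ 17 ∷ 23 ∷ 24 ∷ 26 ∷ 35 ∷ 37 ∷ 47 ∷ 48 ∷ 56 ∷ 58 ∷ 68 ∷ 78 ∷ [])
G₂-edges = pattern₉ (02 ∷ []) ++ G₁-edges
G₃-edges = pattern₉ (13 ∷ []) ++ G₂-edges

-- The five isolated vertices that pad `J4` are dropped again by `_↑ˡ 5`.
J4-embedding : {G : Graph n} → Embedding J4-edges G → Contains G J4
J4-embedding f =
  place f ∘ (_↑ˡ 5) , ↑ˡ-injective 5 _ _ ∘ injective f , λ x y xy → joined f (edges-of-J4 x y xy)
  where
  edges-of-J4 : ∀ x y → Edge J4 x y → Joins J4-edges (x ↑ˡ 5) (y ↑ˡ 5)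
  edges-of-J4 = from-yes (all? λ x → all? λ y →
    (adj J4 x y Bool.≟ true) →-dec joins? J4-edges (x ↑ˡ 5) (y ↑ˡ 5))

loopless? : (E : Pattern n) → Dec (Loopless E)
loopless? = All.all? λ (x , y) → ¬? (x ≟ y)

G₁-loopless : Loopless G₁-edges
G₁-loopless = from-yes (loopless? G₁-edges)
G₂-loopless : Loopless G₂-edges
G₂-loopless = from-yes (loopless? G₂-edges)
G₃-loopless : Loopless G₃-edges
G₃-loopless = from-yes (loopless? G₃-edges)

G₁ G₂ G₃ : Graph 9
G₁ = graph G₁-edges G₁-loopless
G₂ = graph G₂-edges G₂-loopless
G₃ = graph G₃-edges G₃-loopless

-- Along this chain arrowing is inherited upwards and freeness downwards, so only one of each has to
-- be computed: arrowing for `G₁`, freeness for `G₃`.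
G₁⊆G₂ : G₁ ⊆ᴳ G₂
G₁⊆G₂ = from-yes (G₁ ⊆ᴳ? G₂)
G₂⊆G₃ : G₂ ⊆ᴳ G₃
G₂⊆G₃ = from-yes (G₂ ⊆ᴳ? G₃)

G₃-free : Free J4 G₃
G₃-free = DiamondFree⇒Free-J4 {G = G₃} (from-yes (diamondFree? G₃))

G₁-arrows : Arrows G₁ two-two-two
G₁-arrows = MonoEdge⇒Arrows G₁ λ col →
  Uncolourable⇒MonoEdge G₁ col [] (allFin 9) [] (from-yes (uncolourable? {r = 3} G₁ [] (allFin 9)))

G₂-arrows : Arrows G₂ two-two-two
G₂-arrows = Arrows-mono {G = G₁} {G₂} (⊆ᴳ⇒Contains {G = G₁} {G₂} G₁⊆G₂) G₁-arrows

G₃-arrows : Arrows G₃ two-two-two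
G₃-arrows = Arrows-mono {G = G₂} {G₃} (⊆ᴳ⇒Contains {G = G₂} {G₃} G₂⊆G₃) G₂-arrows

G₂-free : Free J4 G₂
G₂-free = Free-mono {G = G₂} {G₃} {J4} (⊆ᴳ⇒Contains {G = G₂} {G₃} G₂⊆G₃) G₃-free

G₁-free : Free J4 G₁
G₁-free = Free-mono {G = G₁} {G₂} {J4} (⊆ᴳ⇒Contains {G = G₁} {G₂} G₁⊆G₂) G₂-free

-- The ith digit of the second component is the image of the vertex i.
hint : ℕ × ℕ → Hint 9
hint (k , π) = k , digits 9 9 π

G₃-hints G₂-hints G₁-hints : List (Hint 9)
G₃-hints = map hint (
    (0 , 073124568) ∷ (0 , 086512347) ∷ (0 , 037124568) ∷ (0 , 078412356) ∷ (0 , 142035678)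
    ∷ (0 , 124035678) ∷ (0 , 185602347) ∷ (0 , 158602347) ∷ (0 , 285601347) ∷ (0 , 217304568)
    ∷ (0 , 278401356) ∷ (0 , 304215678) ∷ (0 , 386501247) ∷ (0 , 368501247) ∷ (0 , 465801237)
    ∷ (0 , 456801237) ∷ (0 , 517302468) ∷ (0 , 637102458) ∷ [])
G₂-hints = map hint (
    (1 , 340215678) ∷ (1 , 086512347) ∷ (1 , 087412356) ∷ (1 , 078412356) ∷ (1 , 142035678)
    ∷ (0 , 103276548) ∷ (1 , 124035678) ∷ (1 , 185602347) ∷ (1 , 158602347) ∷ (1 , 285601347)
    ∷ (1 , 287401356) ∷ (1 , 278401356) ∷ (1 , 304215678) ∷ (1 , 386501247) ∷ (1 , 368501247)
    ∷ (1 , 465801237) ∷ (1 , 456801237) ∷ (1 , 547801236) ∷ (1 , 647801235) ∷ [])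
G₁-hints = map hint (
    (0 , 012345678) ∷ (0 , 013254768) ∷ (2 , 086512347) ∷ (2 , 087412356) ∷ (2 , 078412356)
    ∷ (0 , 102367458) ∷ (0 , 103276548) ∷ (2 , 184702356) ∷ (2 , 185602347) ∷ (2 , 158602347)
    ∷ (2 , 285601347) ∷ (2 , 287401356) ∷ (2 , 278401356) ∷ (2 , 384701256) ∷ (2 , 386501247)
    ∷ (2 , 368501247) ∷ (2 , 465801237) ∷ (2 , 456801237) ∷ (2 , 547801236) ∷ (2 , 647801235) ∷ [])

G₃-covered : Covered (J4-edges ∷ []) G₃-edges (nonEdges G₃-edges) G₃-hints
G₃-covered = from-yes (covered? (J4-edges ∷ []) G₃-edges (nonEdges G₃-edges) G₃-hints)

-- The pair 13 is the one whose hint points to `G₃`; at all others a `J4` is exhibited.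
G₂-covered : Covered (G₃-edges ∷ J4-edges ∷ []) G₂-edges (nonEdges G₂-edges) G₂-hints
G₂-covered = from-yes (covered? (G₃-edges ∷ J4-edges ∷ []) G₂-edges (nonEdges G₂-edges) G₂-hints)

-- The hints point to `G₂` at the four pairs 02, 03, 12, 13 between the edges 01 and 23, and to `J4`
-- elsewhere.
G₁-covered : Covered (G₂-edges ∷ G₃-edges ∷ J4-edges ∷ []) G₁-edges (nonEdges G₁-edges) G₁-hints
G₁-covered = from-yes
  (covered? (G₂-edges ∷ G₃-edges ∷ J4-edges ∷ []) G₁-edges (nonEdges G₁-edges) G₁-hints)

-- The chain of forcing patterns

-- A row lists the edges of a pattern, the colours of the vertices 0 … 8, and one hint for each
-- pair of equally coloured vertices, in lexicographic order.
Row : Set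
Row = List ℕ × ℕ × List (ℕ × ℕ)

decode : Row → Lemma 9
decode (es , c , hs) = pattern₉ es , digits 3 9 c , map hint hs

-- A search tree read from its leaves to its root, cut into consecutive pieces; positions in hints
-- count back across the cuts. A block of rows ends whenever a bare star is reached, and the
-- patterns of the block all contain a star of that size.
rows₁ rows₂ rows₃ rows₄ rows₅ rows₆ rows₇ : List Row
rows₁ =
    ((01 ∷ 02 ∷ 03 ∷ 04 ∷ 05 ∷ 06 ∷ 07 ∷ 08 ∷ 14 ∷ 25 ∷ 38 ∷ []) , 012121122 ,
      (3 , 183024567) ∷ (3 , 125034678) ∷ (3 , 641023578) ∷ (3 , 214035678) ∷ (3 , 752013468)
      ∷ (3 , 238014567) ∷ (3 , 325014678) ∷ (3 , 683012457) ∷ (3 , 714023568) ∷ (3 , 438012567)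
      ∷ (3 , 625013478) ∷ (3 , 738012456) ∷ [])
  ∷ ((01 ∷ 02 ∷ 03 ∷ 04 ∷ 05 ∷ 06 ∷ 07 ∷ 08 ∷ 14 ∷ 25 ∷ []) , 011222112 ,
      (4 , 152034678) ∷ (4 , 641023578) ∷ (4 , 741023568) ∷ (4 , 652013478) ∷ (4 , 752013468)
      ∷ (4 , 314025678) ∷ (4 , 325014678) ∷ (0 , 031284675) ∷ (4 , 425013678) ∷ (4 , 814023567)
      ∷ (4 , 825013467) ∷ (0 , 061274385) ∷ [])
  ∷ ((01 ∷ 02 ∷ 03 ∷ 04 ∷ 05 ∷ 06 ∷ 07 ∷ 08 ∷ 14 ∷ []) , 012122121 ,
      (5 , 341025678) ∷ (5 , 641023578) ∷ (5 , 841023567) ∷ (5 , 214035678) ∷ (0 , 021354678)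
      ∷ (0 , 021374568) ∷ (0 , 031264578) ∷ (0 , 031284567) ∷ (5 , 514023678) ∷ (5 , 714023568)
      ∷ (0 , 051274368) ∷ (0 , 061284357) ∷ [])
  -- The first bare star: vertices of degree eight are settled.
  ∷ ((01 ∷ 02 ∷ 03 ∷ 04 ∷ 05 ∷ 06 ∷ 07 ∷ 08 ∷ []) , 012212211 ,
      (0 , 012345678) ∷ (0 , 012374568) ∷ (0 , 012384567) ∷ (0 , 021435678) ∷ (0 , 021354678)
      ∷ (0 , 021364578) ∷ (0 , 031254678) ∷ (0 , 031264578) ∷ (0 , 041273568) ∷ (0 , 041283567)
      ∷ (0 , 051263478) ∷ (0 , 071283456) ∷ [])
  ∷ ((01 ∷ 02 ∷ 03 ∷ 04 ∷ 05 ∷ 06 ∷ 07 ∷ 12 ∷ 35 ∷ 47 ∷ []) , 012112220 ,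
      (0 , 081234567) ∷ (7 , 153024678) ∷ (7 , 174023568) ∷ (7 , 235014678) ∷ (7 , 612034578)
      ∷ (7 , 247013568) ∷ (7 , 374012568) ∷ (7 , 635012478) ∷ (7 , 547012368) ∷ (7 , 647012358)
      ∷ [])
  ∷ ((01 ∷ 02 ∷ 03 ∷ 04 ∷ 05 ∷ 06 ∷ 07 ∷ 12 ∷ 35 ∷ []) , 012221120 ,
      (1 , 081234567) ∷ (8 , 135024678) ∷ (8 , 621034578) ∷ (8 , 253014678) ∷ (8 , 412035678)
      ∷ (8 , 712034568) ∷ (8 , 453012678) ∷ (8 , 753012468) ∷ (0 , 047132658) ∷ (8 , 635012478)
      ∷ [])
  ∷ ((01 ∷ 02 ∷ 03 ∷ 04 ∷ 05 ∷ 06 ∷ 07 ∷ 12 ∷ []) , 012212120 ,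
      (2 , 081234567) ∷ (9 , 421035678) ∷ (9 , 621034578) ∷ (9 , 312045678) ∷ (9 , 512034678)
      ∷ (9 , 712034568) ∷ (0 , 035142678) ∷ (0 , 037142568) ∷ (0 , 046132578) ∷ (0 , 057132468)
      ∷ [])
  ∷ ((01 ∷ 02 ∷ 03 ∷ 04 ∷ 05 ∷ 06 ∷ 07 ∷ []) , 011221220 ,
      (3 , 081234567) ∷ (0 , 012345678) ∷ (0 , 015234678) ∷ (0 , 025134678) ∷ (0 , 034125678)
      ∷ (0 , 036124578) ∷ (0 , 037124568) ∷ (0 , 046123578) ∷ (0 , 047123568) ∷ (0 , 067123458)
      ∷ [])
  ∷ ((01 ∷ 02 ∷ 03 ∷ 04 ∷ 05 ∷ 07 ∷ 12 ∷ 28 ∷ 37 ∷ 38 ∷ 48 ∷ 58 ∷ []) , 012222011 ,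
      (0 , 061234578) ∷ (11 , 137024568) ∷ (11 , 801234567) ∷ (11 , 273014568) ∷ (11 , 412035678)
      ∷ (11 , 512034678) ∷ (11 , 473012568) ∷ (11 , 573012468) ∷ (11 , 084512367)
      ∷ (11 , 807312456) ∷ [])
  ∷ ((01 ∷ 02 ∷ 03 ∷ 04 ∷ 05 ∷ 07 ∷ 12 ∷ 28 ∷ 37 ∷ 48 ∷ 58 ∷ []) , 012122021 ,
      (1 , 061234578) ∷ (12 , 173024568) ∷ (12 , 801234567) ∷ (12 , 412035678) ∷ (12 , 512034678)
      ∷ (12 , 237014568) ∷ (0 , 073245618) ∷ (12 , 084512367) ∷ (12 , 437012568)
      ∷ (12 , 537012468) ∷ [])
  ∷ ((01 ∷ 02 ∷ 03 ∷ 04 ∷ 05 ∷ 07 ∷ 12 ∷ 28 ∷ 37 ∷ 58 ∷ 78 ∷ []) , 012112021 ,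
      (2 , 061234578) ∷ (13 , 173024568) ∷ (0 , 037125648) ∷ (13 , 801234567) ∷ (13 , 512034678)
      ∷ (13 , 237014568) ∷ (0 , 012357648) ∷ (13 , 803712456) ∷ (0 , 012345678) ∷ (13 , 537012468)
      ∷ [])
  ∷ ((01 ∷ 02 ∷ 03 ∷ 04 ∷ 05 ∷ 07 ∷ 12 ∷ 28 ∷ 37 ∷ 58 ∷ []) , 012212011 ,
      (3 , 061234578) ∷ (14 , 421035678) ∷ (14 , 137024568) ∷ (14 , 801234567) ∷ (14 , 273014568)
      ∷ (14 , 512034678) ∷ (14 , 573012468) ∷ (14 , 437012568) ∷ (1 , 012345678) ∷ (0 , 037145628)
      ∷ [])
  ∷ ((01 ∷ 02 ∷ 03 ∷ 04 ∷ 05 ∷ 07 ∷ 12 ∷ 28 ∷ 37 ∷ 78 ∷ []) , 012112021 ,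
      (4 , 061234578) ∷ (15 , 173024568) ∷ (0 , 037152648) ∷ (15 , 801234567) ∷ (15 , 512034678)
      ∷ (15 , 237014568) ∷ (0 , 012357648) ∷ (15 , 803712456) ∷ (0 , 012354678) ∷ (15 , 537012468)
      ∷ [])
  ∷ ((01 ∷ 02 ∷ 03 ∷ 04 ∷ 05 ∷ 07 ∷ 12 ∷ 28 ∷ 37 ∷ []) , 012221011 ,
      (5 , 061234578) ∷ (16 , 521034678) ∷ (16 , 137024568) ∷ (16 , 801234567) ∷ (16 , 273014568)
      ∷ (16 , 412035678) ∷ (16 , 473012568) ∷ (16 , 537012468) ∷ (1 , 012345678) ∷ (0 , 037145628)
      ∷ [])
  ∷ ((01 ∷ 02 ∷ 03 ∷ 04 ∷ 05 ∷ 07 ∷ 12 ∷ 37 ∷ 58 ∷ []) , 012111220 ,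
      (6 , 081234576) ∷ (17 , 173024568) ∷ (17 , 421035678) ∷ (0 , 015324678) ∷ (0 , 012345876)
      ∷ (17 , 237014568) ∷ (17 , 473012568) ∷ (0 , 035147628) ∷ (0 , 045137628) ∷ (0 , 037145826)
      ∷ [])
  ∷ ((01 ∷ 02 ∷ 03 ∷ 04 ∷ 05 ∷ 07 ∷ 12 ∷ 37 ∷ []) , 012112022 ,
      (7 , 061234578) ∷ (18 , 173024568) ∷ (18 , 421035678) ∷ (18 , 512034678) ∷ (18 , 237014568)
      ∷ (1 , 012345678) ∷ (18 , 473012568) ∷ (18 , 537012468) ∷ (0 , 012345678) ∷ (1 , 037145628)
      ∷ [])
  ∷ ((01 ∷ 02 ∷ 03 ∷ 04 ∷ 05 ∷ 07 ∷ 12 ∷ 28 ∷ []) , 012222021 ,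
      (8 , 061234578) ∷ (19 , 801234567) ∷ (19 , 312045678) ∷ (19 , 412035678) ∷ (19 , 512034678)
      ∷ (19 , 712034568) ∷ (0 , 034157628) ∷ (0 , 035147628) ∷ (0 , 037145628) ∷ (0 , 045137628)
      ∷ (0 , 047135628) ∷ (0 , 057134628) ∷ [])
  ∷ ((01 ∷ 02 ∷ 03 ∷ 04 ∷ 05 ∷ 07 ∷ 12 ∷ []) , 012111012 ,
      (9 , 061234578) ∷ (20 , 321045678) ∷ (20 , 421035678) ∷ (20 , 521034678) ∷ (20 , 721034568)
      ∷ (0 , 012345678) ∷ (1 , 034157628) ∷ (1 , 035147628) ∷ (1 , 037145628) ∷ (1 , 045137628)
      ∷ (1 , 047135628) ∷ (1 , 057134628) ∷ [])
  ∷ ((01 ∷ 02 ∷ 03 ∷ 04 ∷ 05 ∷ 07 ∷ []) , 011111210 ,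
      (10 , 081234576) ∷ (0 , 012345678) ∷ (0 , 013245678) ∷ (0 , 014235678) ∷ (0 , 015234678)
      ∷ (0 , 017234658) ∷ (0 , 023145678) ∷ (0 , 024135678) ∷ (0 , 025134678) ∷ (0 , 027134658)
      ∷ (0 , 034125678) ∷ (0 , 035124678) ∷ (0 , 037124658) ∷ (0 , 045123678) ∷ (0 , 047123658)
      ∷ (0 , 057123648) ∷ [])
  ∷ ((01 ∷ 02 ∷ 04 ∷ 05 ∷ 07 ∷ 13 ∷ 14 ∷ 16 ∷ 25 ∷ 35 ∷ 36 ∷ 38 ∷ []) , 012221010 ,
      (0 , 061245378) ∷ (0 , 081245376) ∷ (22 , 125034678) ∷ (22 , 741023568) ∷ (22 , 302514678)
      ∷ (22 , 214035678) ∷ (22 , 304125678) ∷ (22 , 725013468) ∷ (22 , 816302457) ∷ [])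
  ∷ ((01 ∷ 02 ∷ 04 ∷ 05 ∷ 07 ∷ 13 ∷ 14 ∷ 16 ∷ 25 ∷ 36 ∷ 38 ∷ []) , 011222010 ,
      (1 , 061245378) ∷ (1 , 081245376) ∷ (23 , 152034678) ∷ (23 , 741023568) ∷ (23 , 752013468)
      ∷ (23 , 304125678) ∷ (0 , 012345678) ∷ (23 , 425013678) ∷ (23 , 816302457) ∷ [])
  ∷ ((01 ∷ 02 ∷ 04 ∷ 05 ∷ 07 ∷ 14 ∷ 16 ∷ 23 ∷ 25 ∷ 36 ∷ 37 ∷ 38 ∷ 68 ∷ []) , 012121220 ,
      (2 , 081245376) ∷ (0 , 012345678) ∷ (24 , 125034678) ∷ (24 , 214035678) ∷ (0 , 021654378)
      ∷ (24 , 752013468) ∷ (24 , 305214678) ∷ (24 , 604123578) ∷ (24 , 714023568)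
      ∷ (24 , 786301245) ∷ [])
  ∷ ((01 ∷ 02 ∷ 04 ∷ 05 ∷ 07 ∷ 14 ∷ 16 ∷ 23 ∷ 25 ∷ 36 ∷ 38 ∷ 68 ∷ []) , 012121210 ,
      (3 , 081245376) ∷ (1 , 012345678) ∷ (25 , 125034678) ∷ (25 , 741023568) ∷ (25 , 214035678)
      ∷ (1 , 021654378) ∷ (25 , 305214678) ∷ (0 , 012345678) ∷ (25 , 604123578) ∷ (25 , 725013468)
      ∷ [])
  ∷ ((01 ∷ 02 ∷ 04 ∷ 05 ∷ 07 ∷ 14 ∷ 16 ∷ 23 ∷ 25 ∷ 36 ∷ 38 ∷ []) , 012121020 ,
      (4 , 061245378) ∷ (4 , 081245376) ∷ (2 , 012345678) ∷ (26 , 125034678) ∷ (26 , 214035678)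
      ∷ (26 , 752013468) ∷ (26 , 305214678) ∷ (26 , 714023568) ∷ (0 , 021654378) ∷ [])
  ∷ ((01 ∷ 02 ∷ 04 ∷ 05 ∷ 07 ∷ 14 ∷ 16 ∷ 25 ∷ 36 ∷ 38 ∷ 56 ∷ 68 ∷ 78 ∷ []) , 012121210 ,
      (0 , 081674325) ∷ (0 , 015642378) ∷ (27 , 125034678) ∷ (0 , 075612843) ∷ (27 , 214035678)
      ∷ (0 , 682035714) ∷ (0 , 051624378) ∷ (27 , 763801245) ∷ (0 , 684031752) ∷ (0 , 071654823)
      ∷ [])
  ∷ []

rows₂ =
    ((01 ∷ 02 ∷ 04 ∷ 05 ∷ 07 ∷ 14 ∷ 16 ∷ 25 ∷ 36 ∷ 38 ∷ 56 ∷ 68 ∷ []) , 012221011 ,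
      (6 , 061245378) ∷ (28 , 125034678) ∷ (28 , 741023568) ∷ (1 , 015642873) ∷ (1 , 021654378)
      ∷ (28 , 214035678) ∷ (1 , 045612378) ∷ (28 , 725013468) ∷ (1 , 051624873) ∷ (0 , 012345678)
      ∷ [])
  ∷ ((01 ∷ 02 ∷ 04 ∷ 05 ∷ 07 ∷ 14 ∷ 16 ∷ 25 ∷ 36 ∷ 38 ∷ 67 ∷ 68 ∷ []) , 011122210 ,
      (7 , 081245376) ∷ (29 , 152034678) ∷ (5 , 012345678) ∷ (29 , 741023568) ∷ (2 , 021654378)
      ∷ (0 , 074321658) ∷ (29 , 783601245) ∷ (29 , 425013678) ∷ (29 , 604123578) ∷ (0 , 054321678)
      ∷ [])
  ∷ ((01 ∷ 02 ∷ 04 ∷ 05 ∷ 07 ∷ 14 ∷ 16 ∷ 25 ∷ 36 ∷ 38 ∷ 68 ∷ []) , 011022221 ,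
      (8 , 031245678) ∷ (30 , 152034678) ∷ (6 , 012845673) ∷ (3 , 021654873) ∷ (30 , 425013678)
      ∷ (30 , 604123578) ∷ (30 , 714023568) ∷ (1 , 054321678) ∷ (30 , 725013468) ∷ (0 , 012345678)
      ∷ [])
  ∷ ((01 ∷ 02 ∷ 04 ∷ 05 ∷ 07 ∷ 14 ∷ 16 ∷ 25 ∷ 36 ∷ 38 ∷ []) , 011122020 ,
      (9 , 061245378) ∷ (9 , 081245376) ∷ (31 , 152034678) ∷ (7 , 012345678) ∷ (4 , 012345678)
      ∷ (31 , 425013678) ∷ (31 , 714023568) ∷ (31 , 725013468) ∷ (0 , 012845673) ∷ [])
  ∷ ((01 ∷ 02 ∷ 04 ∷ 05 ∷ 07 ∷ 14 ∷ 25 ∷ 38 ∷ 48 ∷ 58 ∷ []) , 011022021 ,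
      (10 , 031245678) ∷ (10 , 061245378) ∷ (32 , 152034678) ∷ (32 , 801423567) ∷ (32 , 802513467)
      ∷ (0 , 042315876) ∷ (32 , 425013678) ∷ (32 , 714023568) ∷ (32 , 725013468) ∷ [])
  ∷ ((01 ∷ 02 ∷ 04 ∷ 05 ∷ 07 ∷ 14 ∷ 25 ∷ 38 ∷ 48 ∷ []) , 012021021 ,
      (11 , 031245678) ∷ (11 , 061245378) ∷ (33 , 125034678) ∷ (33 , 801423567) ∷ (33 , 214035678)
      ∷ (33 , 752013468) ∷ (1 , 042315876) ∷ (33 , 714023568) ∷ (0 , 021354678) ∷ [])
  ∷ ((01 ∷ 02 ∷ 04 ∷ 05 ∷ 07 ∷ 14 ∷ 16 ∷ 25 ∷ 38 ∷ []) , 011022012 ,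
      (12 , 031245678) ∷ (12 , 061245378) ∷ (34 , 152034678) ∷ (34 , 741023568) ∷ (34 , 752013468)
      ∷ (0 , 042315876) ∷ (34 , 425013678) ∷ (0 , 012345678) ∷ (0 , 021354678) ∷ [])
  ∷ ((01 ∷ 02 ∷ 04 ∷ 05 ∷ 07 ∷ 14 ∷ 16 ∷ 25 ∷ []) , 011022010 ,
      (13 , 031245678) ∷ (13 , 061245378) ∷ (13 , 081245376) ∷ (35 , 152034678) ∷ (35 , 741023568)
      ∷ (35 , 752013468) ∷ (1 , 042315876) ∷ (0 , 012345678) ∷ (35 , 425013678) ∷ (1 , 042815376)
      ∷ [])
  ∷ ((01 ∷ 02 ∷ 04 ∷ 05 ∷ 07 ∷ 14 ∷ 25 ∷ 36 ∷ 38 ∷ 67 ∷ 68 ∷ []) , 012221011 ,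
      (0 , 061574328) ∷ (36 , 125034678) ∷ (0 , 072315648) ∷ (0 , 012345876) ∷ (0 , 021654378)
      ∷ (36 , 214035678) ∷ (0 , 042615378) ∷ (0 , 071354628) ∷ (0 , 051324876) ∷ (36 , 738601245)
      ∷ [])
  ∷ ((01 ∷ 02 ∷ 04 ∷ 05 ∷ 07 ∷ 14 ∷ 25 ∷ 36 ∷ 38 ∷ 68 ∷ []) , 011022221 ,
      (15 , 031245678) ∷ (37 , 152034678) ∷ (1 , 012345876) ∷ (1 , 021354876) ∷ (37 , 425013678)
      ∷ (1 , 042315678) ∷ (37 , 714023568) ∷ (1 , 051324678) ∷ (37 , 725013468) ∷ (0 , 012345678)
      ∷ [])
  ∷ ((01 ∷ 02 ∷ 04 ∷ 05 ∷ 07 ∷ 14 ∷ 25 ∷ 36 ∷ 38 ∷ []) , 011122020 ,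
      (16 , 061245378) ∷ (16 , 081245376) ∷ (38 , 152034678) ∷ (2 , 012645378) ∷ (2 , 021654378)
      ∷ (38 , 425013678) ∷ (38 , 714023568) ∷ (38 , 725013468) ∷ (0 , 012645873) ∷ [])
  ∷ ((01 ∷ 02 ∷ 04 ∷ 05 ∷ 07 ∷ 14 ∷ 25 ∷ 38 ∷ []) , 011022012 ,
      (17 , 031245678) ∷ (17 , 061245378) ∷ (39 , 152034678) ∷ (39 , 741023568) ∷ (39 , 752013468)
      ∷ (0 , 012345678) ∷ (39 , 425013678) ∷ (3 , 042315876) ∷ (3 , 051324876) ∷ [])
  ∷ ((01 ∷ 02 ∷ 04 ∷ 05 ∷ 07 ∷ 14 ∷ 25 ∷ []) , 012021120 ,
      (18 , 031245678) ∷ (18 , 081245376) ∷ (40 , 125034678) ∷ (4 , 012345678) ∷ (40 , 214035678)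
      ∷ (40 , 752013468) ∷ (0 , 012345678) ∷ (40 , 714023568) ∷ (4 , 051324678) ∷ [])
  ∷ ((01 ∷ 02 ∷ 04 ∷ 05 ∷ 07 ∷ 13 ∷ 14 ∷ 23 ∷ 36 ∷ 37 ∷ 38 ∷ 68 ∷ []) , 011222011 ,
      (19 , 061245378) ∷ (0 , 316028475) ∷ (0 , 316078425) ∷ (41 , 168302457) ∷ (0 , 021374658)
      ∷ (41 , 268301457) ∷ (0 , 346018527) ∷ (19 , 351267084) ∷ (41 , 514023678)
      ∷ (41 , 768301245) ∷ [])
  ∷ ((01 ∷ 02 ∷ 04 ∷ 05 ∷ 07 ∷ 13 ∷ 14 ∷ 23 ∷ 36 ∷ 38 ∷ 68 ∷ []) , 011222021 ,
      (20 , 061245378) ∷ (42 , 241035678) ∷ (42 , 168302457) ∷ (42 , 268301457) ∷ (1 , 346018527)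
      ∷ (0 , 015347628) ∷ (0 , 017345628) ∷ (42 , 514023678) ∷ (42 , 714023568) ∷ (1 , 051374628)
      ∷ [])
  ∷ ((01 ∷ 02 ∷ 04 ∷ 05 ∷ 07 ∷ 13 ∷ 14 ∷ 36 ∷ 38 ∷ 68 ∷ []) , 012222120 ,
      (21 , 081245376) ∷ (43 , 186302457) ∷ (0 , 012345678) ∷ (43 , 214035678) ∷ (2 , 021354678)
      ∷ (2 , 021374658) ∷ (43 , 304125678) ∷ (0 , 015342678) ∷ (0 , 017342658) ∷ (43 , 514023678)
      ∷ (43 , 714023568) ∷ (2 , 051374628) ∷ [])
  ∷ ((01 ∷ 02 ∷ 04 ∷ 05 ∷ 07 ∷ 14 ∷ 16 ∷ 36 ∷ 68 ∷ []) , 011021210 ,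
      (22 , 031245678) ∷ (22 , 081245376) ∷ (44 , 241035678) ∷ (44 , 541023678) ∷ (44 , 741023568)
      ∷ (3 , 021354678) ∷ (3 , 021374658) ∷ (0 , 012645378) ∷ (44 , 604123578) ∷ (3 , 051374628)
      ∷ [])
  ∷ ((01 ∷ 02 ∷ 04 ∷ 05 ∷ 07 ∷ 14 ∷ 36 ∷ 48 ∷ 68 ∷ []) , 012022120 ,
      (23 , 031245678) ∷ (23 , 081245376) ∷ (0 , 012345678) ∷ (45 , 214035678) ∷ (4 , 021354678)
      ∷ (4 , 021374658) ∷ (0 , 042315876) ∷ (45 , 514023678) ∷ (45 , 714023568) ∷ (4 , 051374628)
      ∷ [])
  ∷ ((01 ∷ 02 ∷ 04 ∷ 05 ∷ 07 ∷ 13 ∷ 14 ∷ 36 ∷ []) , 011221010 ,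
      (24 , 061245378) ∷ (24 , 081245376) ∷ (46 , 241035678) ∷ (46 , 541023678) ∷ (46 , 741023568)
      ∷ (5 , 021354678) ∷ (5 , 021374658) ∷ (46 , 304125678) ∷ (5 , 051374628) ∷ (0 , 042815673)
      ∷ [])
  ∷ ((01 ∷ 02 ∷ 04 ∷ 05 ∷ 07 ∷ 14 ∷ 28 ∷ 38 ∷ 58 ∷ 68 ∷ 78 ∷ []) , 012221120 ,
      (0 , 803125467) ∷ (0 , 052814376) ∷ (0 , 012645873) ∷ (0 , 825036174) ∷ (0 , 021845376)
      ∷ (0 , 021874356) ∷ (0 , 042315876) ∷ (0 , 872035164) ∷ (0 , 071842356) ∷ (0 , 852063174)
      ∷ [])
  ∷ ((01 ∷ 02 ∷ 04 ∷ 05 ∷ 07 ∷ 14 ∷ 28 ∷ 36 ∷ 38 ∷ 58 ∷ 68 ∷ []) , 012022211 ,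
      (26 , 031245678) ∷ (48 , 741023568) ∷ (0 , 831462750) ∷ (1 , 021845376) ∷ (1 , 021854376)
      ∷ (48 , 236801457) ∷ (1 , 051842376) ∷ (1 , 042615378) ∷ (48 , 536801247) ∷ (0 , 837162450)
      ∷ [])
  ∷ ((01 ∷ 02 ∷ 04 ∷ 05 ∷ 07 ∷ 14 ∷ 28 ∷ 36 ∷ 38 ∷ 68 ∷ []) , 012221011 ,
      (27 , 061245378) ∷ (49 , 541023678) ∷ (49 , 741023568) ∷ (2 , 012845376) ∷ (49 , 263801457)
      ∷ (2 , 021845376) ∷ (2 , 042315678) ∷ (8 , 051374628) ∷ (0 , 015342678) ∷ (0 , 017342658)
      ∷ [])
  ∷ ((01 ∷ 02 ∷ 04 ∷ 05 ∷ 07 ∷ 14 ∷ 36 ∷ 38 ∷ 68 ∷ []) , 011022221 ,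
      (28 , 031245678) ∷ (50 , 241035678) ∷ (3 , 012845376) ∷ (0 , 012345678) ∷ (50 , 514023678)
      ∷ (3 , 042615378) ∷ (50 , 714023568) ∷ (0 , 015342876) ∷ (9 , 051374628) ∷ (0 , 017342856)
      ∷ [])
  ∷ ((01 ∷ 02 ∷ 04 ∷ 05 ∷ 07 ∷ 14 ∷ 36 ∷ 68 ∷ []) , 011221012 ,
      (29 , 061245378) ∷ (51 , 241035678) ∷ (51 , 541023678) ∷ (51 , 741023568) ∷ (10 , 021354678)
      ∷ (10 , 021374658) ∷ (4 , 042315678) ∷ (0 , 012345876) ∷ (4 , 042815673) ∷ (10 , 051374628)
      ∷ [])
  ∷ ((01 ∷ 02 ∷ 04 ∷ 05 ∷ 07 ∷ 14 ∷ 36 ∷ []) , 012122020 ,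
      (30 , 061245378) ∷ (30 , 081245376) ∷ (5 , 012345678) ∷ (52 , 214035678) ∷ (11 , 021354678)
      ∷ (11 , 021374658) ∷ (52 , 514023678) ∷ (52 , 714023568) ∷ (11 , 051374628)
      ∷ (0 , 012845673) ∷ [])
  ∷ []

rows₃ =
    ((01 ∷ 02 ∷ 04 ∷ 05 ∷ 07 ∷ 14 ∷ []) , 012022010 ,
      (31 , 031245678) ∷ (31 , 061245378) ∷ (31 , 081245376) ∷ (53 , 741023568) ∷ (53 , 214035678)
      ∷ (12 , 021354678) ∷ (0 , 012345678) ∷ (0 , 012345876) ∷ (53 , 514023678) ∷ (0 , 012645873)
      ∷ [])
  ∷ ((01 ∷ 02 ∷ 04 ∷ 05 ∷ 07 ∷ 18 ∷ 28 ∷ 36 ∷ 38 ∷ 68 ∷ []) , 011022122 ,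
      (32 , 031245678) ∷ (0 , 014325678) ∷ (54 , 136802457) ∷ (54 , 236801457) ∷ (0 , 041352678)
      ∷ (0 , 041372658) ∷ (0 , 834061527) ∷ (0 , 051372648) ∷ (0 , 835061427) ∷ (0 , 837061425)
      ∷ [])
  ∷ ((01 ∷ 02 ∷ 04 ∷ 05 ∷ 07 ∷ 18 ∷ 36 ∷ 38 ∷ 68 ∷ []) , 012022122 ,
      (33 , 031245678) ∷ (55 , 136802457) ∷ (1 , 021345678) ∷ (1 , 021354678) ∷ (1 , 021374658)
      ∷ (0 , 021345678) ∷ (1 , 041352678) ∷ (1 , 041372658) ∷ (0 , 041325678) ∷ (1 , 051372648)
      ∷ (0 , 051324678) ∷ (0 , 071324658) ∷ [])
  ∷ ((01 ∷ 02 ∷ 04 ∷ 05 ∷ 07 ∷ 36 ∷ 38 ∷ 68 ∷ []) , 011022221 ,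
      (34 , 031245678) ∷ (2 , 014325678) ∷ (0 , 012345678) ∷ (0 , 021345678) ∷ (2 , 041352678)
      ∷ (0 , 041325876) ∷ (2 , 041372658) ∷ (0 , 051324876) ∷ (2 , 051372648) ∷ (0 , 071324856)
      ∷ [])
  ∷ ((01 ∷ 02 ∷ 04 ∷ 05 ∷ 07 ∷ 38 ∷ 68 ∷ []) , 011211210 ,
      (35 , 081245376) ∷ (3 , 014325678) ∷ (3 , 012345678) ∷ (3 , 012354678) ∷ (3 , 012374658)
      ∷ (3 , 021345678) ∷ (3 , 021354678) ∷ (3 , 021374658) ∷ (0 , 012345678) ∷ (3 , 041352678)
      ∷ (3 , 041372658) ∷ (3 , 051372648) ∷ [])
  ∷ ((01 ∷ 02 ∷ 04 ∷ 05 ∷ 07 ∷ 38 ∷ []) , 011011212 ,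
      (36 , 031245678) ∷ (4 , 014325678) ∷ (4 , 012345678) ∷ (4 , 012354678) ∷ (4 , 012374658)
      ∷ (4 , 021345678) ∷ (4 , 021354678) ∷ (4 , 021374658) ∷ (4 , 041352678) ∷ (4 , 041372658)
      ∷ (4 , 051372648) ∷ (0 , 012645378) ∷ [])
  -- After this row only graphs of maximum degree at most four are left; `G₃` is 4-regular.
  ∷ ((01 ∷ 02 ∷ 04 ∷ 05 ∷ 07 ∷ []) , 012022010 ,
      (37 , 031245678) ∷ (37 , 061245378) ∷ (37 , 081245376) ∷ (5 , 012374658) ∷ (5 , 021345678)
      ∷ (5 , 021354678) ∷ (0 , 012345876) ∷ (0 , 012345678) ∷ (5 , 041352678) ∷ (0 , 012645378)
      ∷ [])
  ∷ ((02 ∷ 04 ∷ 05 ∷ 07 ∷ 12 ∷ 13 ∷ 16 ∷ 18 ∷ 27 ∷ 28 ∷ 35 ∷ 56 ∷ []) , 012012010 ,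
      (0 , 032145678) ∷ (0 , 062145378) ∷ (0 , 082145376) ∷ (0 , 142036587) ∷ (0 , 172036485)
      ∷ (0 , 250317486) ∷ (60 , 153602478) ∷ (60 , 328104567) ∷ (60 , 427013568)
      ∷ (60 , 628103457) ∷ [])
  ∷ ((02 ∷ 04 ∷ 05 ∷ 07 ∷ 12 ∷ 13 ∷ 16 ∷ 18 ∷ 27 ∷ 28 ∷ 56 ∷ []) , 012212010 ,
      (1 , 062145378) ∷ (1 , 082145376) ∷ (1 , 142036587) ∷ (1 , 172036485) ∷ (1 , 230417586)
      ∷ (1 , 250317486) ∷ (0 , 012345678) ∷ (61 , 427013568) ∷ (61 , 628103457) ∷ [])
  ∷ ((02 ∷ 04 ∷ 05 ∷ 07 ∷ 12 ∷ 13 ∷ 16 ∷ 18 ∷ 27 ∷ 28 ∷ []) , 012012210 ,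
      (2 , 032145678) ∷ (2 , 082145376) ∷ (2 , 142036587) ∷ (2 , 172036485) ∷ (2 , 250317486)
      ∷ (2 , 260317485) ∷ (62 , 328104567) ∷ (62 , 427013568) ∷ (0 , 012345678) ∷ [])
  ∷ ((02 ∷ 04 ∷ 05 ∷ 07 ∷ 12 ∷ 13 ∷ 16 ∷ 18 ∷ 27 ∷ 36 ∷ 56 ∷ []) , 012212010 ,
      (0 , 016247853) ∷ (3 , 082145376) ∷ (3 , 142036587) ∷ (3 , 172036485) ∷ (0 , 102468537)
      ∷ (63 , 572013468) ∷ (63 , 513602478) ∷ (63 , 427013568) ∷ (63 , 836102457) ∷ [])
  ∷ ((02 ∷ 04 ∷ 05 ∷ 07 ∷ 12 ∷ 13 ∷ 16 ∷ 18 ∷ 27 ∷ 36 ∷ []) , 012012210 ,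
      (4 , 032145678) ∷ (4 , 082145376) ∷ (4 , 142036587) ∷ (4 , 172036485) ∷ (64 , 572013468)
      ∷ (1 , 102438567) ∷ (64 , 863102457) ∷ (64 , 427013568) ∷ (0 , 012345678) ∷ [])
  ∷ ((02 ∷ 04 ∷ 05 ∷ 07 ∷ 12 ∷ 13 ∷ 16 ∷ 18 ∷ 27 ∷ []) , 012012010 ,
      (5 , 032145678) ∷ (5 , 062145378) ∷ (5 , 082145376) ∷ (5 , 142036587) ∷ (5 , 172036485)
      ∷ (65 , 572013468) ∷ (0 , 012345678) ∷ (0 , 012345876) ∷ (65 , 427013568) ∷ (0 , 012645873)
      ∷ [])
  ∷ ((02 ∷ 04 ∷ 05 ∷ 07 ∷ 12 ∷ 13 ∷ 16 ∷ 18 ∷ 36 ∷ 45 ∷ 56 ∷ []) , 012212010 ,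
      (0 , 016247358) ∷ (6 , 082145376) ∷ (0 , 014327658) ∷ (6 , 172036485) ∷ (0 , 102468537)
      ∷ (0 , 012347658) ∷ (66 , 513602478) ∷ (66 , 754012368) ∷ (0 , 065827143) ∷ [])
  ∷ ((02 ∷ 04 ∷ 05 ∷ 07 ∷ 12 ∷ 13 ∷ 16 ∷ 18 ∷ 36 ∷ 45 ∷ []) , 012012210 ,
      (1 , 103428567) ∷ (7 , 082145376) ∷ (1 , 014327658) ∷ (7 , 172036485) ∷ (1 , 012347658)
      ∷ (1 , 102438567) ∷ (67 , 863102457) ∷ (67 , 754012368) ∷ (0 , 012345678) ∷ [])
  ∷ ((02 ∷ 04 ∷ 05 ∷ 07 ∷ 12 ∷ 13 ∷ 16 ∷ 18 ∷ 36 ∷ []) , 012011210 ,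
      (2 , 103428567) ∷ (8 , 082145376) ∷ (8 , 142036587) ∷ (8 , 152036487) ∷ (8 , 172036485)
      ∷ (2 , 102438567) ∷ (68 , 863102457) ∷ (0 , 102436587) ∷ (0 , 102436785) ∷ (0 , 102536784)
      ∷ [])
  ∷ ((02 ∷ 04 ∷ 05 ∷ 07 ∷ 12 ∷ 13 ∷ 16 ∷ 18 ∷ []) , 001211212 ,
      (9 , 012345678) ∷ (3 , 012357648) ∷ (3 , 012347658) ∷ (3 , 012345678) ∷ (0 , 012345678)
      ∷ (0 , 012345876) ∷ (0 , 102436587) ∷ (0 , 102436785) ∷ (0 , 102536784) ∷ (0 , 012645873)
      ∷ [])
  ∷ ((02 ∷ 04 ∷ 05 ∷ 07 ∷ 13 ∷ 16 ∷ 18 ∷ 25 ∷ 28 ∷ 38 ∷ 78 ∷ []) , 011022012 ,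
      (10 , 032145678) ∷ (0 , 082164357) ∷ (0 , 102436587) ∷ (0 , 107236485) ∷ (70 , 752013468)
      ∷ (70 , 683102457) ∷ (70 , 425013678) ∷ (10 , 841023576) ∷ (10 , 851023476) ∷ [])
  ∷ ((02 ∷ 04 ∷ 05 ∷ 07 ∷ 13 ∷ 16 ∷ 18 ∷ 25 ∷ 28 ∷ 38 ∷ []) , 011012022 ,
      (11 , 032145678) ∷ (11 , 062145378) ∷ (1 , 102436587) ∷ (1 , 104236587) ∷ (71 , 452013678)
      ∷ (71 , 683102457) ∷ (71 , 725013468) ∷ (71 , 805213467) ∷ (0 , 012345678) ∷ [])
  ∷ ((02 ∷ 04 ∷ 05 ∷ 07 ∷ 13 ∷ 16 ∷ 18 ∷ 25 ∷ 38 ∷ 78 ∷ []) , 011212020 ,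
      (12 , 062145378) ∷ (12 , 082145376) ∷ (2 , 102436587) ∷ (2 , 104236587) ∷ (72 , 452013678)
      ∷ (0 , 015842673) ∷ (72 , 713802456) ∷ (0 , 017325648) ∷ (2 , 807261435) ∷ [])
  ∷ ((02 ∷ 04 ∷ 05 ∷ 07 ∷ 13 ∷ 16 ∷ 18 ∷ 25 ∷ 38 ∷ []) , 012011022 ,
      (13 , 032145678) ∷ (13 , 062145378) ∷ (3 , 104236587) ∷ (3 , 105236487) ∷ (73 , 752013468)
      ∷ (1 , 012345678) ∷ (73 , 683102457) ∷ (73 , 425013678) ∷ (0 , 012345678) ∷ [])
  ∷ ((02 ∷ 04 ∷ 05 ∷ 07 ∷ 13 ∷ 16 ∷ 18 ∷ 25 ∷ []) , 011022010 ,
      (14 , 032145678) ∷ (14 , 062145378) ∷ (14 , 082145376) ∷ (4 , 102436587) ∷ (4 , 107236485)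
      ∷ (74 , 752013468) ∷ (0 , 012345876) ∷ (0 , 012345678) ∷ (74 , 425013678) ∷ (0 , 012645378)
      ∷ [])
  ∷ ((02 ∷ 04 ∷ 05 ∷ 07 ∷ 13 ∷ 16 ∷ 18 ∷ 38 ∷ []) , 011011212 ,
      (15 , 032145678) ∷ (0 , 103428567) ∷ (0 , 103248567) ∷ (0 , 103258467) ∷ (0 , 103278465)
      ∷ (0 , 012354678) ∷ (0 , 012345678) ∷ (0 , 012347658) ∷ (0 , 014325678) ∷ (0 , 014327658)
      ∷ (0 , 015327648) ∷ (75 , 638102457) ∷ [])
  ∷ ((02 ∷ 04 ∷ 05 ∷ 07 ∷ 13 ∷ 16 ∷ 18 ∷ []) , 001211212 ,
      (16 , 012345678) ∷ (1 , 012354678) ∷ (1 , 012345678) ∷ (1 , 012347658) ∷ (0 , 012345876)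
      ∷ (0 , 012345678) ∷ (1 , 014325678) ∷ (1 , 014327658) ∷ (1 , 015327648) ∷ (0 , 012645378)
      ∷ [])
  -- Here the search meets a genuine solution: 74 rows precede, so position 74 in the hint for the
  -- last pair, 78, is `G₁`.
  ∷ ((02 ∷ 04 ∷ 05 ∷ 07 ∷ 15 ∷ 16 ∷ 17 ∷ 18 ∷ 25 ∷ 26 ∷ 28 ∷ 34 ∷ 35 ∷ 38 ∷ 46 ∷ 47 ∷ []) , 011012222 ,
      (0 , 013624758) ∷ (0 , 142056387) ∷ (0 , 154067283) ∷ (0 , 412503768) ∷ (17 , 560412738)
      ∷ (17 , 570412638) ∷ (0 , 548301627) ∷ (77 , 607412358) ∷ (0 , 806412537) ∷ (74 , 831672540)
      ∷ [])
  ∷ []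

rows₄ =
    ((02 ∷ 04 ∷ 05 ∷ 07 ∷ 15 ∷ 16 ∷ 17 ∷ 18 ∷ 26 ∷ 28 ∷ 34 ∷ 35 ∷ 36 ∷ 38 ∷ 47 ∷ []) , 001122212 ,
      (1 , 031524678) ∷ (1 , 372056184) ∷ (1 , 732501648) ∷ (18 , 374056182) ∷ (78 , 574012368)
      ∷ (0 , 413206578) ∷ (0 , 413208576) ∷ (78 , 135602478) ∷ (78 , 135802467) ∷ (1 , 608412537)
      ∷ [])
  ∷ ((04 ∷ 05 ∷ 07 ∷ 15 ∷ 16 ∷ 17 ∷ 18 ∷ 25 ∷ 26 ∷ 28 ∷ 34 ∷ 35 ∷ 38 ∷ 47 ∷ 78 ∷ []) , 001122212 ,
      (19 , 105267384) ∷ (2 , 273056184) ∷ (19 , 720314586) ∷ (2 , 723501648) ∷ (2 , 514602738)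
      ∷ (0 , 486503172) ∷ (19 , 841023576) ∷ (2 , 576102438) ∷ (19 , 580412637) ∷ (2 , 806412537)
      ∷ [])
  ∷ ((02 ∷ 04 ∷ 05 ∷ 07 ∷ 15 ∷ 16 ∷ 17 ∷ 18 ∷ 25 ∷ 26 ∷ 28 ∷ 34 ∷ 35 ∷ 38 ∷ 47 ∷ []) , 011012022 ,
      (3 , 013624758) ∷ (3 , 086145273) ∷ (3 , 142056387) ∷ (3 , 154067283) ∷ (3 , 412503678)
      ∷ (1 , 032175648) ∷ (20 , 570412638) ∷ (20 , 580412637) ∷ (0 , 721348605) ∷ [])
  ∷ ((02 ∷ 04 ∷ 05 ∷ 07 ∷ 15 ∷ 16 ∷ 17 ∷ 18 ∷ 25 ∷ 26 ∷ 28 ∷ 34 ∷ 35 ∷ 47 ∷ []) , 011012020 ,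
      (4 , 013624758) ∷ (21 , 062145378) ∷ (21 , 082145376) ∷ (4 , 142056387) ∷ (4 , 154067283)
      ∷ (4 , 412503678) ∷ (0 , 012345876) ∷ (0 , 012345678) ∷ (21 , 570412638) ∷ (81 , 126803457)
      ∷ [])
  ∷ ((02 ∷ 04 ∷ 05 ∷ 07 ∷ 15 ∷ 16 ∷ 17 ∷ 18 ∷ 25 ∷ 26 ∷ 28 ∷ 35 ∷ 47 ∷ []) , 011112020 ,
      (22 , 062145378) ∷ (22 , 082145376) ∷ (22 , 125067384) ∷ (5 , 103256487) ∷ (5 , 154067283)
      ∷ (5 , 273056184) ∷ (22 , 240156387) ∷ (0 , 012345678) ∷ (22 , 570412638) ∷ (82 , 126803457)
      ∷ [])
  ∷ ((02 ∷ 04 ∷ 05 ∷ 07 ∷ 16 ∷ 17 ∷ 18 ∷ 25 ∷ 26 ∷ 28 ∷ 35 ∷ 47 ∷ []) , 012211020 ,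
      (23 , 062145378) ∷ (23 , 082145376) ∷ (6 , 154067283) ∷ (0 , 012345678) ∷ (6 , 273056184)
      ∷ (23 , 270156384) ∷ (6 , 723501648) ∷ (6 , 514602738) ∷ (83 , 126803457) ∷ [])
  ∷ ((02 ∷ 04 ∷ 05 ∷ 07 ∷ 16 ∷ 17 ∷ 18 ∷ 25 ∷ 26 ∷ 28 ∷ 47 ∷ []) , 011212020 ,
      (24 , 062145378) ∷ (24 , 082145376) ∷ (24 , 210356487) ∷ (84 , 104723568) ∷ (24 , 240156387)
      ∷ (0 , 012345678) ∷ (7 , 723501648) ∷ (84 , 547012368) ∷ (84 , 126803457) ∷ [])
  ∷ ((02 ∷ 04 ∷ 05 ∷ 07 ∷ 16 ∷ 18 ∷ 25 ∷ 26 ∷ 28 ∷ 37 ∷ 47 ∷ []) , 011112020 ,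
      (25 , 062145378) ∷ (25 , 082145376) ∷ (8 , 271056384) ∷ (8 , 012345678) ∷ (0 , 012375648)
      ∷ (25 , 230156487) ∷ (25 , 240156387) ∷ (85 , 304712568) ∷ (85 , 547012368)
      ∷ (85 , 126803457) ∷ [])
  ∷ ((02 ∷ 04 ∷ 05 ∷ 07 ∷ 16 ∷ 18 ∷ 25 ∷ 26 ∷ 28 ∷ 47 ∷ []) , 011122010 ,
      (26 , 062145378) ∷ (26 , 082145376) ∷ (26 , 210356487) ∷ (9 , 012345678) ∷ (1 , 012345678)
      ∷ (26 , 230156487) ∷ (26 , 270156384) ∷ (0 , 012345678) ∷ (86 , 425013678)
      ∷ (86 , 126803457) ∷ [])
  ∷ ((02 ∷ 04 ∷ 05 ∷ 07 ∷ 16 ∷ 18 ∷ 25 ∷ 26 ∷ 28 ∷ []) , 011122020 ,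
      (27 , 062145378) ∷ (27 , 082145376) ∷ (27 , 210356487) ∷ (10 , 012345678) ∷ (27 , 230156487)
      ∷ (87 , 425013678) ∷ (0 , 012345678) ∷ (87 , 725013468) ∷ (87 , 126803457) ∷ [])
  ∷ ((02 ∷ 04 ∷ 05 ∷ 07 ∷ 12 ∷ 16 ∷ 18 ∷ 25 ∷ 26 ∷ 35 ∷ 36 ∷ 37 ∷ 46 ∷ 48 ∷ 58 ∷ []) , 012221010 ,
      (0 , 086352174) ∷ (0 , 068325174) ∷ (0 , 175462083) ∷ (85 , 738410562) ∷ (0 , 245713068)
      ∷ (0 , 230814567) ∷ (0 , 230815467) ∷ (0 , 560137284) ∷ (0 , 608721435) ∷ [])
  ∷ ((02 ∷ 04 ∷ 05 ∷ 07 ∷ 12 ∷ 16 ∷ 18 ∷ 25 ∷ 26 ∷ 36 ∷ 37 ∷ 46 ∷ 48 ∷ 58 ∷ []) , 012121020 ,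
      (1 , 086352174) ∷ (1 , 068325174) ∷ (1 , 032845176) ∷ (89 , 105234678) ∷ (1 , 014352678)
      ∷ (1 , 280317465) ∷ (0 , 012345678) ∷ (1 , 276801453) ∷ (1 , 608721435) ∷ [])
  ∷ ((02 ∷ 04 ∷ 05 ∷ 07 ∷ 12 ∷ 16 ∷ 18 ∷ 25 ∷ 26 ∷ 36 ∷ 46 ∷ 48 ∷ 58 ∷ []) , 012211020 ,
      (2 , 086352174) ∷ (2 , 068325174) ∷ (2 , 654721038) ∷ (90 , 105234678) ∷ (2 , 286703154)
      ∷ (2 , 280317465) ∷ (0 , 012345678) ∷ (2 , 014325678) ∷ (2 , 608721435) ∷ [])
  ∷ ((02 ∷ 04 ∷ 05 ∷ 07 ∷ 12 ∷ 16 ∷ 18 ∷ 25 ∷ 26 ∷ 46 ∷ 48 ∷ 58 ∷ []) , 012011022 ,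
      (14 , 013245678) ∷ (3 , 086352174) ∷ (91 , 421603578) ∷ (91 , 105234678) ∷ (3 , 280317465)
      ∷ (3 , 012345876) ∷ (0 , 652741038) ∷ (3 , 014325678) ∷ (3 , 280315764) ∷ [])
  ∷ ((02 ∷ 04 ∷ 05 ∷ 16 ∷ 18 ∷ 23 ∷ 25 ∷ 26 ∷ 46 ∷ 48 ∷ 58 ∷ []) , 012011022 ,
      (92 , 350214678) ∷ (4 , 286730154) ∷ (92 , 681402357) ∷ (0 , 285760134) ∷ (15 , 287103465)
      ∷ (4 , 268705134) ∷ (4 , 286703154) ∷ (92 , 425013678) ∷ (15 , 827014356) ∷ [])
  ∷ ((02 ∷ 04 ∷ 05 ∷ 07 ∷ 16 ∷ 18 ∷ 25 ∷ 26 ∷ 46 ∷ 48 ∷ 58 ∷ []) , 011122020 ,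
      (5 , 086352174) ∷ (5 , 068325174) ∷ (0 , 560782431) ∷ (16 , 012345678) ∷ (0 , 012345678)
      ∷ (5 , 014325678) ∷ (5 , 014327658) ∷ (0 , 015742836) ∷ (93 , 146802357) ∷ [])
  ∷ ((02 ∷ 04 ∷ 05 ∷ 07 ∷ 16 ∷ 18 ∷ 25 ∷ 26 ∷ 46 ∷ 48 ∷ []) , 001012212 ,
      (34 , 012345678) ∷ (34 , 032145678) ∷ (17 , 012345678) ∷ (6 , 014352678) ∷ (94 , 752013468)
      ∷ (6 , 014327658) ∷ (94 , 605213478) ∷ (0 , 015342876) ∷ (94 , 146802357) ∷ [])
  ∷ ((02 ∷ 04 ∷ 05 ∷ 07 ∷ 16 ∷ 18 ∷ 25 ∷ 26 ∷ 48 ∷ 78 ∷ []) , 001122221 ,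
      (35 , 012345678) ∷ (7 , 280135467) ∷ (7 , 012345876) ∷ (18 , 823014576) ∷ (95 , 425013678)
      ∷ (0 , 012345678) ∷ (95 , 084712356) ∷ (95 , 605213478) ∷ (95 , 725013468) ∷ (0 , 012375648)
      ∷ [])
  ∷ ((02 ∷ 04 ∷ 05 ∷ 07 ∷ 16 ∷ 18 ∷ 25 ∷ 26 ∷ 48 ∷ []) , 001022211 ,
      (36 , 012345678) ∷ (36 , 032145678) ∷ (19 , 012345678) ∷ (96 , 752013468) ∷ (8 , 012345876)
      ∷ (96 , 425013678) ∷ (1 , 012345678) ∷ (96 , 605213478) ∷ (0 , 012375648) ∷ [])
  ∷ ((02 ∷ 04 ∷ 05 ∷ 07 ∷ 16 ∷ 18 ∷ 25 ∷ 26 ∷ 46 ∷ 67 ∷ []) , 001012212 ,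
      (37 , 012345678) ∷ (37 , 032145678) ∷ (20 , 012345678) ∷ (97 , 452013678) ∷ (97 , 752013468)
      ∷ (97 , 064712358) ∷ (37 , 651024378) ∷ (0 , 015342876) ∷ (37 , 681024375) ∷ [])
  ∷ ((02 ∷ 04 ∷ 05 ∷ 07 ∷ 16 ∷ 18 ∷ 25 ∷ 26 ∷ 67 ∷ []) , 001022211 ,
      (38 , 012345678) ∷ (38 , 032145678) ∷ (21 , 012345678) ∷ (98 , 752013468) ∷ (1 , 012375846)
      ∷ (98 , 425013678) ∷ (0 , 012345678) ∷ (98 , 605213478) ∷ (1 , 012375648) ∷ [])
  ∷ ((02 ∷ 04 ∷ 05 ∷ 07 ∷ 16 ∷ 18 ∷ 25 ∷ 26 ∷ []) , 001012221 ,
      (39 , 012345678) ∷ (39 , 032145678) ∷ (22 , 012345678) ∷ (99 , 452013678) ∷ (11 , 012345876)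
      ∷ (2 , 012345678) ∷ (99 , 605213478) ∷ (99 , 725013468) ∷ (0 , 012345678) ∷ [])
  ∷ ((02 ∷ 04 ∷ 05 ∷ 07 ∷ 16 ∷ 18 ∷ 46 ∷ 67 ∷ 68 ∷ []) , 012011022 ,
      (23 , 063124758) ∷ (40 , 062145378) ∷ (100 , 481602357) ∷ (0 , 601348572) ∷ (0 , 017342658)
      ∷ (0 , 608341275) ∷ (23 , 603214587) ∷ (0 , 014325678) ∷ (100 , 718602345) ∷ [])
  ∷ ((02 ∷ 04 ∷ 05 ∷ 07 ∷ 16 ∷ 18 ∷ 25 ∷ 46 ∷ 68 ∷ []) , 011012220 ,
      (24 , 063125478) ∷ (41 , 082145376) ∷ (1 , 062345178) ∷ (101 , 481602357) ∷ (1 , 014352678)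
      ∷ (24 , 082345176) ∷ (0 , 012357648) ∷ (101 , 725013468) ∷ (0 , 621378045) ∷ [])
  ∷ ((02 ∷ 04 ∷ 05 ∷ 07 ∷ 16 ∷ 18 ∷ 25 ∷ 46 ∷ []) , 001022121 ,
      (42 , 012345678) ∷ (42 , 032145678) ∷ (25 , 012345678) ∷ (2 , 012345678) ∷ (2 , 012345876)
      ∷ (2 , 014325678) ∷ (2 , 014327658) ∷ (102 , 725013468) ∷ (0 , 082345671) ∷ [])
  ∷ []

rows₅ =
    ((02 ∷ 04 ∷ 05 ∷ 07 ∷ 16 ∷ 18 ∷ 25 ∷ []) , 001012122 ,
      (43 , 012345678) ∷ (43 , 032145678) ∷ (26 , 012345678) ∷ (103 , 452013678) ∷ (3 , 012345678)
      ∷ (0 , 012345678) ∷ (103 , 725013468) ∷ (3 , 015342876) ∷ (0 , 012375846) ∷ [])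
  ∷ ((02 ∷ 04 ∷ 05 ∷ 07 ∷ 12 ∷ 16 ∷ 18 ∷ 68 ∷ []) , 012011210 ,
      (27 , 013245678) ∷ (44 , 082145376) ∷ (0 , 106348527) ∷ (0 , 106358427) ∷ (0 , 106378425)
      ∷ (104 , 286103457) ∷ (27 , 082345176) ∷ (0 , 014325678) ∷ (0 , 014327658) ∷ (0 , 015327648)
      ∷ [])
  ∷ ((02 ∷ 04 ∷ 05 ∷ 07 ∷ 16 ∷ 18 ∷ 68 ∷ []) , 011012220 ,
      (45 , 032145678) ∷ (45 , 082145376) ∷ (0 , 012345678) ∷ (0 , 014325678) ∷ (1 , 012354678)
      ∷ (28 , 082345176) ∷ (0 , 065324178) ∷ (1 , 015327648) ∷ (0 , 067324158) ∷ [])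
  ∷ ((02 ∷ 04 ∷ 05 ∷ 07 ∷ 16 ∷ 18 ∷ []) , 012122020 ,
      (46 , 062145378) ∷ (46 , 082145376) ∷ (29 , 012345678) ∷ (2 , 012354678) ∷ (2 , 012345678)
      ∷ (2 , 012347658) ∷ (2 , 014325678) ∷ (2 , 014327658) ∷ (2 , 015327648) ∷ (0 , 062345871)
      ∷ [])
  ∷ ((02 ∷ 04 ∷ 05 ∷ 07 ∷ 12 ∷ 14 ∷ 25 ∷ 28 ∷ 38 ∷ 47 ∷ []) , 012221010 ,
      (0 , 026345178) ∷ (47 , 082145376) ∷ (107 , 105234678) ∷ (107 , 107423568) ∷ (0 , 243605187)
      ∷ (47 , 240315687) ∷ (0 , 423601578) ∷ (107 , 547012368) ∷ (0 , 082145673) ∷ [])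
  ∷ ((02 ∷ 04 ∷ 05 ∷ 07 ∷ 12 ∷ 14 ∷ 25 ∷ 38 ∷ 47 ∷ []) , 012021012 ,
      (48 , 032145678) ∷ (48 , 062145378) ∷ (108 , 105234678) ∷ (108 , 107423568)
      ∷ (108 , 274013568) ∷ (0 , 012345678) ∷ (1 , 032145678) ∷ (0 , 014327658)
      ∷ (108 , 547012368) ∷ [])
  ∷ ((02 ∷ 04 ∷ 05 ∷ 07 ∷ 12 ∷ 14 ∷ 25 ∷ 47 ∷ []) , 012021010 ,
      (49 , 032145678) ∷ (49 , 062145378) ∷ (49 , 082145376) ∷ (109 , 105234678)
      ∷ (109 , 107423568) ∷ (109 , 274013568) ∷ (0 , 012345876) ∷ (0 , 012345678)
      ∷ (109 , 547012368) ∷ (0 , 012645378) ∷ [])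
  ∷ ((02 ∷ 04 ∷ 05 ∷ 07 ∷ 12 ∷ 25 ∷ 28 ∷ 38 ∷ 47 ∷ []) , 001012122 ,
      (3 , 081645273) ∷ (3 , 023645178) ∷ (3 , 032645178) ∷ (50 , 240315687) ∷ (3 , 206315487)
      ∷ (3 , 240315687) ∷ (110 , 547012368) ∷ (110 , 805213467) ∷ (0 , 087124356) ∷ [])
  ∷ ((02 ∷ 04 ∷ 05 ∷ 07 ∷ 12 ∷ 16 ∷ 25 ∷ 47 ∷ 78 ∷ []) , 001022112 ,
      (51 , 012345678) ∷ (4 , 013845276) ∷ (4 , 012845376) ∷ (0 , 240865317) ∷ (111 , 247013568)
      ∷ (111 , 425013678) ∷ (111 , 804712356) ∷ (1 , 085172346) ∷ (0 , 087124356) ∷ [])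
  ∷ ((02 ∷ 04 ∷ 05 ∷ 07 ∷ 12 ∷ 25 ∷ 38 ∷ 47 ∷ []) , 012011022 ,
      (52 , 032145678) ∷ (52 , 062145378) ∷ (2 , 014327658) ∷ (112 , 105234678)
      ∷ (112 , 247013568) ∷ (1 , 012345678) ∷ (5 , 032145678) ∷ (112 , 425013678)
      ∷ (0 , 087654321) ∷ [])
  ∷ ((02 ∷ 04 ∷ 05 ∷ 07 ∷ 12 ∷ 16 ∷ 25 ∷ 47 ∷ []) , 012011022 ,
      (6 , 013845276) ∷ (53 , 062145378) ∷ (3 , 014327658) ∷ (113 , 105234678) ∷ (113 , 247013568)
      ∷ (0 , 082145376) ∷ (0 , 012345876) ∷ (113 , 425013678) ∷ (0 , 087124356) ∷ [])
  ∷ ((02 ∷ 04 ∷ 05 ∷ 07 ∷ 12 ∷ 16 ∷ 25 ∷ 26 ∷ []) , 012011022 ,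
      (7 , 013845276) ∷ (54 , 062145378) ∷ (4 , 241306758) ∷ (114 , 105234678) ∷ (54 , 270315468)
      ∷ (7 , 208315467) ∷ (7 , 062845371) ∷ (114 , 425013678) ∷ (0 , 270315864) ∷ [])
  ∷ ((02 ∷ 04 ∷ 05 ∷ 07 ∷ 12 ∷ 16 ∷ 25 ∷ 58 ∷ []) , 001022121 ,
      (55 , 012345678) ∷ (8 , 013845276) ∷ (8 , 012845376) ∷ (0 , 062345178) ∷ (115 , 802513467)
      ∷ (115 , 425013678) ∷ (1 , 012345678) ∷ (115 , 725013468) ∷ (8 , 062345871) ∷ [])
  ∷ ((02 ∷ 04 ∷ 05 ∷ 07 ∷ 12 ∷ 16 ∷ 25 ∷ []) , 012021021 ,
      (9 , 013845276) ∷ (56 , 062145378) ∷ (116 , 105234678) ∷ (9 , 012345876) ∷ (116 , 452013678)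
      ∷ (116 , 752013468) ∷ (9 , 062845371) ∷ (2 , 012345678) ∷ (0 , 012345678) ∷ [])
  ∷ ((02 ∷ 04 ∷ 05 ∷ 07 ∷ 16 ∷ 23 ∷ 25 ∷ []) , 001212210 ,
      (57 , 012345678) ∷ (57 , 082145376) ∷ (10 , 012345876) ∷ (117 , 452013678)
      ∷ (117 , 752013468) ∷ (117 , 305214678) ∷ (0 , 032145678) ∷ (4 , 032145876)
      ∷ (0 , 065342178) ∷ [])
  ∷ ((02 ∷ 04 ∷ 05 ∷ 07 ∷ 16 ∷ 25 ∷ 47 ∷ []) , 012011022 ,
      (58 , 032145678) ∷ (58 , 062145378) ∷ (1 , 014327658) ∷ (1 , 015342678) ∷ (118 , 247013568)
      ∷ (0 , 012845673) ∷ (11 , 062845371) ∷ (118 , 425013678) ∷ (0 , 017824653) ∷ [])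
  ∷ ((02 ∷ 04 ∷ 05 ∷ 07 ∷ 16 ∷ 25 ∷ []) , 011122020 ,
      (59 , 062145378) ∷ (59 , 082145376) ∷ (2 , 012345678) ∷ (12 , 012845376) ∷ (1 , 012345678)
      ∷ (119 , 425013678) ∷ (0 , 014327658) ∷ (119 , 725013468) ∷ (12 , 062345871) ∷ [])
  ∷ ((02 ∷ 04 ∷ 05 ∷ 07 ∷ 16 ∷ []) , 012022021 ,
      (60 , 032145678) ∷ (60 , 062145378) ∷ (13 , 012345876) ∷ (0 , 012354678) ∷ (0 , 012345678)
      ∷ (0 , 012347658) ∷ (13 , 062845371) ∷ (0 , 014325678) ∷ (0 , 014327658) ∷ (0 , 015327648)
      ∷ [])
  ∷ ((02 ∷ 04 ∷ 05 ∷ 07 ∷ 27 ∷ []) , 001021020 ,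
      (61 , 012345678) ∷ (61 , 032145678) ∷ (61 , 062145378) ∷ (61 , 082145376) ∷ (0 , 012645378)
      ∷ (0 , 012345678) ∷ (0 , 012345876) ∷ (121 , 572013468) ∷ (0 , 032145678) ∷ (0 , 032145876)
      ∷ (121 , 427013568) ∷ (0 , 062145873) ∷ [])
  -- The star with four edges is settled; what follows treats maximum degree at most three.
  ∷ ((02 ∷ 04 ∷ 05 ∷ 07 ∷ []) , 001211212 ,
      (62 , 012345678) ∷ (0 , 012357648) ∷ (0 , 012347658) ∷ (0 , 012345678) ∷ (1 , 032145678)
      ∷ (1 , 032145876) ∷ (0 , 014327658) ∷ (0 , 014325678) ∷ (0 , 015324678) ∷ (1 , 062145873)
      ∷ [])
  ∷ ((02 ∷ 04 ∷ 05 ∷ 13 ∷ 16 ∷ 18 ∷ 24 ∷ 34 ∷ 36 ∷ []) , 001121202 ,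
      (0 , 031624758) ∷ (0 , 017324658) ∷ (0 , 107236485) ∷ (0 , 302514768) ∷ (123 , 542013678)
      ∷ (0 , 305214768) ∷ (0 , 416502738) ∷ (0 , 418502637) ∷ (123 , 836102457) ∷ [])
  ∷ ((02 ∷ 04 ∷ 05 ∷ 13 ∷ 16 ∷ 18 ∷ 24 ∷ 34 ∷ 67 ∷ 78 ∷ []) , 011021020 ,
      (1 , 013624758) ∷ (1 , 016324758) ∷ (1 , 018324657) ∷ (1 , 102436587) ∷ (1 , 105236487)
      ∷ (124 , 542013678) ∷ (0 , 601437285) ∷ (0 , 801437265) ∷ (1 , 417502638)
      ∷ (124 , 176802345) ∷ [])
  ∷ ((02 ∷ 04 ∷ 05 ∷ 13 ∷ 16 ∷ 18 ∷ 24 ∷ 34 ∷ 78 ∷ []) , 011021220 ,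
      (2 , 013624758) ∷ (2 , 018324657) ∷ (2 , 102436587) ∷ (2 , 105236487) ∷ (125 , 542013678)
      ∷ (1 , 801437265) ∷ (2 , 416502738) ∷ (2 , 417502638) ∷ (0 , 012345678) ∷ [])
  ∷ ((02 ∷ 04 ∷ 05 ∷ 13 ∷ 16 ∷ 18 ∷ 24 ∷ 34 ∷ []) , 011021022 ,
      (3 , 013624758) ∷ (3 , 016324758) ∷ (3 , 102436587) ∷ (3 , 105236487) ∷ (126 , 542013678)
      ∷ (2 , 106438275) ∷ (3 , 417502638) ∷ (3 , 418502637) ∷ (0 , 012345678) ∷ [])
  ∷ ((02 ∷ 04 ∷ 05 ∷ 13 ∷ 16 ∷ 18 ∷ 24 ∷ 36 ∷ []) , 001221102 ,
      (4 , 031624758) ∷ (4 , 017324658) ∷ (4 , 107236485) ∷ (127 , 542013678) ∷ (0 , 103268475)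
      ∷ (0 , 012345678) ∷ (127 , 863102457) ∷ (0 , 012845376) ∷ (0 , 103568274) ∷ [])
  ∷ []

rows₆ =
    ((02 ∷ 04 ∷ 05 ∷ 13 ∷ 16 ∷ 18 ∷ 24 ∷ []) , 012211202 ,
      (5 , 017324658) ∷ (5 , 104236587) ∷ (5 , 105236487) ∷ (1 , 014325678) ∷ (1 , 014625378)
      ∷ (1 , 014825376) ∷ (0 , 103268475) ∷ (0 , 103286475) ∷ (128 , 524013678) ∷ (0 , 106283475)
      ∷ [])
  ∷ ((02 ∷ 04 ∷ 05 ∷ 13 ∷ 16 ∷ 18 ∷ []) , 001211202 ,
      (6 , 031624758) ∷ (6 , 017324658) ∷ (6 , 107236485) ∷ (0 , 012345678) ∷ (0 , 012354678)
      ∷ (0 , 103268475) ∷ (0 , 103286475) ∷ (0 , 014352678) ∷ (0 , 106283475) ∷ [])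
  ∷ ((02 ∷ 04 ∷ 05 ∷ 13 ∷ 16 ∷ 24 ∷ 34 ∷ 35 ∷ 67 ∷ []) , 012012010 ,
      (7 , 013624758) ∷ (7 , 016324758) ∷ (7 , 018324657) ∷ (7 , 451602738) ∷ (0 , 107236485)
      ∷ (130 , 542013678) ∷ (0 , 603217485) ∷ (7 , 308214657) ∷ (7 , 417502638) ∷ (0 , 608217435)
      ∷ [])
  ∷ ((02 ∷ 04 ∷ 05 ∷ 13 ∷ 16 ∷ 24 ∷ 34 ∷ 35 ∷ []) , 012012001 ,
      (8 , 013624758) ∷ (8 , 016324758) ∷ (8 , 017324658) ∷ (8 , 451602738) ∷ (1 , 108236475)
      ∷ (131 , 542013678) ∷ (8 , 306214758) ∷ (8 , 307214658) ∷ (8 , 418502637) ∷ (0 , 012345678)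
      ∷ [])
  ∷ ((02 ∷ 04 ∷ 05 ∷ 13 ∷ 16 ∷ 24 ∷ 34 ∷ 67 ∷ []) , 001121202 ,
      (0 , 462103758) ∷ (9 , 017324658) ∷ (2 , 107236485) ∷ (132 , 302415678) ∷ (132 , 542013678)
      ∷ (0 , 012345678) ∷ (9 , 416502738) ∷ (9 , 418502637) ∷ (2 , 608217435) ∷ [])
  ∷ ((02 ∷ 04 ∷ 05 ∷ 13 ∷ 16 ∷ 24 ∷ 34 ∷ []) , 001121220 ,
      (10 , 031624758) ∷ (10 , 018324657) ∷ (3 , 108236475) ∷ (133 , 302415678)
      ∷ (133 , 542013678) ∷ (1 , 012345678) ∷ (10 , 416502738) ∷ (10 , 417502638)
      ∷ (0 , 012345678) ∷ [])
  ∷ ((02 ∷ 04 ∷ 05 ∷ 13 ∷ 15 ∷ 16 ∷ 24 ∷ 36 ∷ []) , 011222001 ,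
      (0 , 123065478) ∷ (4 , 017324586) ∷ (0 , 034125678) ∷ (4 , 108236475) ∷ (0 , 214508367)
      ∷ (0 , 306514278) ∷ (0 , 321056478) ∷ (0 , 430152678) ∷ (0 , 603517248) ∷ [])
  ∷ ((02 ∷ 04 ∷ 05 ∷ 13 ∷ 24 ∷ 36 ∷ 47 ∷ []) , 001221102 ,
      (1 , 432107658) ∷ (12 , 017324658) ∷ (1 , 012745368) ∷ (135 , 542013678) ∷ (1 , 034625178)
      ∷ (12 , 413502678) ∷ (5 , 308216475) ∷ (12 , 418302576) ∷ (1 , 462507318) ∷ [])
  ∷ ((02 ∷ 04 ∷ 05 ∷ 13 ∷ 16 ∷ 24 ∷ 36 ∷ []) , 011221020 ,
      (13 , 016324758) ∷ (13 , 018324657) ∷ (2 , 034125678) ∷ (1 , 103265478) ∷ (136 , 542013678)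
      ∷ (2 , 012345678) ∷ (6 , 307216485) ∷ (0 , 432107658) ∷ (6 , 608213475) ∷ [])
  ∷ ((02 ∷ 04 ∷ 05 ∷ 13 ∷ 16 ∷ 24 ∷ 57 ∷ 58 ∷ []) , 001222201 ,
      (14 , 031624758) ∷ (1 , 037152684) ∷ (7 , 107236485) ∷ (1 , 234108657) ∷ (3 , 012345678)
      ∷ (14 , 513207486) ∷ (0 , 032645178) ∷ (1 , 534107628) ∷ (3 , 012645378) ∷ (14 , 516207384)
      ∷ [])
  ∷ ((02 ∷ 04 ∷ 05 ∷ 13 ∷ 16 ∷ 24 ∷ 57 ∷ []) , 001221201 ,
      (15 , 031624758) ∷ (15 , 017324658) ∷ (8 , 107236485) ∷ (2 , 532107648) ∷ (2 , 234108657)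
      ∷ (4 , 012345678) ∷ (1 , 032645178) ∷ (4 , 012645378) ∷ (0 , 012345687) ∷ [])
  ∷ ((02 ∷ 04 ∷ 05 ∷ 13 ∷ 16 ∷ 24 ∷ []) , 001221210 ,
      (16 , 031624758) ∷ (16 , 018324657) ∷ (9 , 108236475) ∷ (139 , 542013678) ∷ (3 , 234107658)
      ∷ (5 , 012345678) ∷ (2 , 032645178) ∷ (5 , 012645378) ∷ (0 , 012345678) ∷ [])
  ∷ ((02 ∷ 04 ∷ 05 ∷ 13 ∷ 16 ∷ 36 ∷ []) , 012022201 ,
      (17 , 013624758) ∷ (17 , 017324658) ∷ (0 , 103268457) ∷ (0 , 012345678) ∷ (0 , 012354678)
      ∷ (0 , 601432578) ∷ (0 , 301267458) ∷ (0 , 014352678) ∷ (0 , 601234578) ∷ (0 , 601235478)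
      ∷ [])
  ∷ ((04 ∷ 05 ∷ 13 ∷ 23 ∷ 28 ∷ 37 ∷ 68 ∷ 78 ∷ []) , 011022012 ,
      (11 , 083245617) ∷ (11 , 036145287) ∷ (1 , 201438567) ∷ (1 , 701438526) ∷ (1 , 207438516)
      ∷ (18 , 306412578) ∷ (0 , 341527068) ∷ (18 , 804126375) ∷ (18 , 805126374) ∷ [])
  ∷ ((02 ∷ 04 ∷ 05 ∷ 13 ∷ 23 ∷ 37 ∷ 68 ∷ 78 ∷ []) , 011222001 ,
      (12 , 036145287) ∷ (19 , 017324658) ∷ (2 , 281630745) ∷ (0 , 061845273) ∷ (0 , 062845173)
      ∷ (0 , 814367520) ∷ (0 , 815367420) ∷ (1 , 341527068) ∷ (1 , 062745813) ∷ [])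
  ∷ ((02 ∷ 04 ∷ 05 ∷ 13 ∷ 16 ∷ 37 ∷ 68 ∷ 78 ∷ []) , 001221210 ,
      (20 , 031624758) ∷ (20 , 018324657) ∷ (2 , 012845637) ∷ (3 , 012354678) ∷ (0 , 082745631)
      ∷ (0 , 074325816) ∷ (2 , 032645178) ∷ (0 , 084625713) ∷ (0 , 085724631) ∷ [])
  ∷ ((02 ∷ 04 ∷ 05 ∷ 13 ∷ 16 ∷ 37 ∷ 78 ∷ []) , 001211202 ,
      (21 , 031624758) ∷ (21 , 017324658) ∷ (3 , 012745368) ∷ (4 , 012345678) ∷ (4 , 012354678)
      ∷ (3 , 032645178) ∷ (3 , 032845716) ∷ (4 , 014352678) ∷ (0 , 062845173) ∷ [])
  ∷ ((02 ∷ 04 ∷ 05 ∷ 13 ∷ 16 ∷ 78 ∷ []) , 001211220 ,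
      (22 , 031624758) ∷ (22 , 018324657) ∷ (15 , 108236475) ∷ (5 , 012345678) ∷ (5 , 012354678)
      ∷ (4 , 032645178) ∷ (0 , 072345816) ∷ (5 , 014352678) ∷ (0 , 072645813) ∷ [])
  ∷ ((02 ∷ 04 ∷ 05 ∷ 13 ∷ 16 ∷ []) , 012022011 ,
      (23 , 013624758) ∷ (23 , 016324758) ∷ (16 , 107236485) ∷ (16 , 108236475) ∷ (6 , 012345678)
      ∷ (6 , 012354678) ∷ (5 , 032645178) ∷ (6 , 014352678) ∷ (0 , 012345678) ∷ [])
  ∷ ((02 ∷ 04 ∷ 05 ∷ 13 ∷ 14 ∷ 24 ∷ 78 ∷ []) , 011022002 ,
      (24 , 013624758) ∷ (0 , 016325478) ∷ (0 , 017325468) ∷ (147 , 102435678) ∷ (0 , 032645178)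
      ∷ (0 , 032745168) ∷ (24 , 435601728) ∷ (24 , 438501627) ∷ (0 , 480512736) ∷ (0 , 072645813)
      ∷ [])
  ∷ ((02 ∷ 04 ∷ 05 ∷ 13 ∷ 14 ∷ 24 ∷ []) , 001221022 ,
      (25 , 031624758) ∷ (1 , 016325478) ∷ (1 , 106234578) ∷ (148 , 542013678) ∷ (25 , 453601728)
      ∷ (1 , 032745168) ∷ (1 , 032845167) ∷ (25 , 437501628) ∷ (25 , 438501627) ∷ (0 , 012345678)
      ∷ [])
  ∷ ((02 ∷ 04 ∷ 05 ∷ 13 ∷ 24 ∷ 48 ∷ []) , 011221020 ,
      (26 , 016324758) ∷ (26 , 018324657) ∷ (0 , 014325678) ∷ (0 , 452108367) ∷ (149 , 542013678)
      ∷ (0 , 032145678) ∷ (2 , 032745168) ∷ (26 , 417302586) ∷ (0 , 082645137) ∷ [])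
  ∷ ((02 ∷ 04 ∷ 05 ∷ 13 ∷ 24 ∷ 57 ∷ 58 ∷ []) , 001221102 ,
      (3 , 051724836) ∷ (0 , 017352468) ∷ (3 , 012745368) ∷ (0 , 512307684) ∷ (0 , 214306785)
      ∷ (1 , 452703168) ∷ (3 , 032845167) ∷ (0 , 412308675) ∷ (3 , 506278413) ∷ [])
  ∷ ((02 ∷ 04 ∷ 05 ∷ 13 ∷ 24 ∷ 57 ∷ []) , 001221201 ,
      (28 , 031624758) ∷ (28 , 017324658) ∷ (4 , 012745368) ∷ (1 , 512307684) ∷ (1 , 214308675)
      ∷ (2 , 452703168) ∷ (4 , 032645178) ∷ (1 , 412306785) ∷ (0 , 012345687) ∷ [])
  ∷ ((02 ∷ 04 ∷ 05 ∷ 13 ∷ 24 ∷ []) , 001221210 ,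
      (29 , 031624758) ∷ (29 , 018324657) ∷ (5 , 012845367) ∷ (152 , 542013678) ∷ (2 , 214307685)
      ∷ (3 , 032145678) ∷ (5 , 032645178) ∷ (2 , 412306785) ∷ (0 , 012345678) ∷ [])
  ∷ []

rows₇ =
    ((02 ∷ 04 ∷ 05 ∷ 13 ∷ 78 ∷ []) , 001211220 ,
      (30 , 031624758) ∷ (30 , 018324657) ∷ (6 , 012845367) ∷ (0 , 012345678) ∷ (0 , 012354678)
      ∷ (6 , 032645178) ∷ (6 , 032745168) ∷ (0 , 014352678) ∷ (6 , 072645813) ∷ [])
  ∷ ((02 ∷ 04 ∷ 05 ∷ 13 ∷ []) , 001211022 ,
      (31 , 031624758) ∷ (31 , 016324758) ∷ (7 , 012645378) ∷ (1 , 012345678) ∷ (1 , 012354678)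
      ∷ (7 , 032745168) ∷ (7 , 032845167) ∷ (1 , 014352678) ∷ (0 , 072845613) ∷ [])
  ∷ ((02 ∷ 04 ∷ 05 ∷ 24 ∷ []) , 001022000 ,
      (32 , 031624758) ∷ (32 , 013624758) ∷ (32 , 016324758) ∷ (32 , 017324658) ∷ (32 , 018324657)
      ∷ (0 , 012345678) ∷ (0 , 012645378) ∷ (0 , 012745368) ∷ (0 , 012845367) ∷ (0 , 032645178)
      ∷ (0 , 032745168) ∷ (0 , 032845167) ∷ (155 , 524013678) ∷ (0 , 062745138) ∷ (0 , 062845137)
      ∷ (0 , 072845136) ∷ [])
  ∷ ((02 ∷ 04 ∷ 05 ∷ []) , 012122100 ,
      (33 , 017324658) ∷ (33 , 018324657) ∷ (1 , 012345678) ∷ (1 , 012645378) ∷ (0 , 012345678)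
      ∷ (0 , 012354678) ∷ (1 , 032645178) ∷ (0 , 014352678) ∷ (1 , 072845136) ∷ [])
  ∷ ((02 ∷ 05 ∷ 12 ∷ 13 ∷ 36 ∷ 45 ∷ 47 ∷ []) , 012021102 ,
      (0 , 013425678) ∷ (0 , 017325468) ∷ (0 , 105423678) ∷ (0 , 106423578) ∷ (0 , 234501678)
      ∷ (0 , 238401567) ∷ (0 , 307216458) ∷ (0 , 408157236) ∷ (0 , 516204378) ∷ [])
  ∷ ((02 ∷ 05 ∷ 12 ∷ 13 ∷ 36 ∷ 45 ∷ []) , 012021120 ,
      (1 , 013425678) ∷ (1 , 018325467) ∷ (1 , 105423678) ∷ (1 , 106423578) ∷ (1 , 234501678)
      ∷ (1 , 237401568) ∷ (1 , 308216457) ∷ (0 , 250431768) ∷ (1 , 516204378) ∷ [])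
  ∷ ((02 ∷ 05 ∷ 12 ∷ 13 ∷ 36 ∷ []) , 001202112 ,
      (2 , 031425678) ∷ (2 , 014325678) ∷ (2 , 104523678) ∷ (2 , 236401578) ∷ (2 , 237401568)
      ∷ (2 , 305216478) ∷ (2 , 308216457) ∷ (0 , 102563847) ∷ (0 , 231650748) ∷ [])
  ∷ ((02 ∷ 05 ∷ 12 ∷ 13 ∷ 46 ∷ 48 ∷ []) , 012021120 ,
      (3 , 013425678) ∷ (0 , 820154367) ∷ (3 , 105423678) ∷ (0 , 621034578) ∷ (3 , 234501678)
      ∷ (3 , 237401568) ∷ (0 , 813254067) ∷ (3 , 407168235) ∷ (0 , 605234178) ∷ [])
  ∷ ((02 ∷ 05 ∷ 12 ∷ 13 ∷ 46 ∷ []) , 012012021 ,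
      (4 , 013425678) ∷ (1 , 620154378) ∷ (1 , 421036578) ∷ (4 , 108423567) ∷ (4 , 235401678)
      ∷ (4 , 237401568) ∷ (1 , 613254078) ∷ (0 , 012345876) ∷ (1 , 520147368) ∷ [])
  ∷ ((02 ∷ 05 ∷ 12 ∷ 13 ∷ []) , 001211022 ,
      (5 , 031425678) ∷ (5 , 016325478) ∷ (5 , 106423578) ∷ (5 , 234501678) ∷ (5 , 235401678)
      ∷ (2 , 321047568) ∷ (2 , 321048567) ∷ (2 , 520164378) ∷ (0 , 012375846) ∷ [])
  ∷ ((02 ∷ 05 ∷ 12 ∷ 36 ∷ 38 ∷ 68 ∷ []) , 012102210 ,
      (6 , 014325678) ∷ (0 , 038612457) ∷ (0 , 163802457) ∷ (0 , 102537468) ∷ (6 , 235401678)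
      ∷ (0 , 236810457) ∷ (6 , 307168245) ∷ (6 , 804136257) ∷ (0 , 536810247) ∷ [])
  ∷ ((02 ∷ 05 ∷ 12 ∷ 36 ∷ 38 ∷ []) , 012122010 ,
      (1 , 036812457) ∷ (1 , 038612457) ∷ (1 , 321046578) ∷ (1 , 102537468) ∷ (7 , 234501678)
      ∷ (7 , 235401678) ∷ (7 , 307168245) ∷ (1 , 520134678) ∷ (0 , 012645873) ∷ [])
  ∷ ((02 ∷ 05 ∷ 12 ∷ 36 ∷ []) , 001202112 ,
      (8 , 031425678) ∷ (8 , 014325678) ∷ (2 , 102534678) ∷ (2 , 602513478) ∷ (8 , 237401568)
      ∷ (2 , 305216478) ∷ (0 , 012345876) ∷ (2 , 520138467) ∷ (0 , 012645783) ∷ [])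
  ∷ ((02 ∷ 05 ∷ 12 ∷ []) , 012122100 ,
      (9 , 017325468) ∷ (9 , 018325467) ∷ (3 , 102543678) ∷ (3 , 102536478) ∷ (9 , 234501678)
      ∷ (9 , 235401678) ∷ (0 , 012345678) ∷ (3 , 520134678) ∷ (0 , 012735846) ∷ [])
  ∷ ((02 ∷ 05 ∷ 14 ∷ 16 ∷ []) , 012201201 ,
      (0 , 014352678) ∷ (10 , 017325468) ∷ (0 , 105234678) ∷ (10 , 108246357) ∷ (0 , 250143678)
      ∷ (0 , 216340578) ∷ (0 , 641023578) ∷ (0 , 461027358) ∷ (0 , 520138467) ∷ [])
  ∷ ((02 ∷ 05 ∷ 14 ∷ 38 ∷ []) , 012201201 ,
      (1 , 014352678) ∷ (11 , 017325468) ∷ (1 , 105234678) ∷ (0 , 108324567) ∷ (1 , 283140567)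
      ∷ (1 , 250136478) ∷ (0 , 306128547) ∷ (0 , 407321568) ∷ (1 , 538120467) ∷ [])
  ∷ ((02 ∷ 05 ∷ 14 ∷ []) , 012021120 ,
      (12 , 013425678) ∷ (12 , 018325467) ∷ (2 , 105234678) ∷ (1 , 106324578) ∷ (2 , 214350678)
      ∷ (2 , 250137468) ∷ (0 , 032185674) ∷ (1 , 407321568) ∷ (2 , 520136478) ∷ [])
  ∷ ((02 ∷ 05 ∷ []) , 011212200 ,
      (13 , 017325468) ∷ (13 , 018325467) ∷ (3 , 250341678) ∷ (0 , 012345678) ∷ (3 , 250134678)
      ∷ (3 , 520143678) ∷ (0 , 032165478) ∷ (3 , 520136478) ∷ (0 , 072185346) ∷ [])
  ∷ ((02 ∷ 16 ∷ 34 ∷ []) , 012101202 ,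
      (0 , 014352678) ∷ (0 , 017342568) ∷ (0 , 103246578) ∷ (0 , 105236478) ∷ (0 , 216340578)
      ∷ (0 , 218340567) ∷ (0 , 305124678) ∷ (0 , 407123568) ∷ (0 , 608231457) ∷ [])
  ∷ ((02 ∷ 16 ∷ []) , 001220211 ,
      (1 , 031452678) ∷ (1 , 015342678) ∷ (1 , 105236478) ∷ (1 , 217340568) ∷ (1 , 218340567)
      ∷ (0 , 304165278) ∷ (1 , 603241578) ∷ (1 , 604231578) ∷ (0 , 708163245) ∷ [])
  ∷ ((02 ∷ []) , 012220110 ,
      (2 , 015342678) ∷ (2 , 018342567) ∷ (0 , 106345278) ∷ (0 , 107345268) ∷ (2 , 213450678)
      ∷ (2 , 214350678) ∷ (0 , 304156278) ∷ (0 , 508134267) ∷ (0 , 607134258) ∷ [])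
  ∷ ([] , 010212102 ,
      (0 , 012345678) ∷ (0 , 017234568) ∷ (0 , 104235678) ∷ (0 , 106234578) ∷ (0 , 207134568)
      ∷ (0 , 305124678) ∷ (0 , 308124567) ∷ (0 , 406123578) ∷ (0 , 508123467) ∷ [])
  ∷ []

table : List (Lemma 9)
table = map decode (rows₁ ++ rows₂ ++ rows₃ ++ rows₄ ++ rows₅ ++ rows₆ ++ rows₇)

-- Classification

abstract
  -- The whole chain is verified by evaluating `valid?` once; `abstract` keeps the resulting proof
  -- from being unfolded afterwards.
  table-valid : Valid (G₁-edges ∷ G₂-edges ∷ G₃-edges ∷ J4-edges ∷ []) table
  table-valid = toWitness {a? = valid? (G₁-edges ∷ G₂-edges ∷ G₃-edges ∷ J4-edges ∷ []) table} tt

classification : (G : Graph 9) → InF two-two-two J4 G → Iso G G₁ ⊎ (Iso G G₂ ⊎ Iso G G₃)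
classification G (free , arrows) =
  valid⇒goal (Arrows⇒MonoEdge G arrows) (force₁ ∷ force₂ ∷ force₃ ∷ forceⱼ ∷ [])
    table table-valid
  where
  open Consequences G (Iso G G₁ ⊎ (Iso G G₂ ⊎ Iso G G₃))

  forceⱼ : Forces J4-edges
  forceⱼ f = contradiction (J4-embedding {G = G} f) free

  force₃ : Forces G₃-edges
  force₃ = exact-step G₃-loopless (forceⱼ ∷ []) G₃-covered (inj₂ ∘ inj₂)

  force₂ : Forces G₂-edges
  force₂ = exact-step G₂-loopless (force₃ ∷ forceⱼ ∷ []) G₂-covered (inj₂ ∘ inj₁)

  force₁ : Forces G₁-edges
  force₁ = exact-step G₁-loopless (force₂ ∷ force₃ ∷ forceⱼ ∷ []) G₁-covered inj₁

-- Maximality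

-- The certificate that settles the proper extensions of `E` also proves saturation: it is applied
-- to the identity embedding of `E` into the graph with the edge `ij` added, with a copy of `J4`
-- there as the goal.
covered⇒saturated : (E : Pattern 9) (loopless : Loopless E) {hs : List (Hint 9)} →
  Covered (J4-edges ∷ []) E (nonEdges E) hs →
  ∀ i j (i≢j : i ≢ j) → ¬ Edge (graph E loopless) i j →
  Contains (addEdge (graph E loopless) i j i≢j) J4
covered⇒saturated E loopless covered i j i≢j ¬ij = by-order (<-cmp i j)
  where
  G G+ij : Graph 9
  G    = graph E loopless
  G+ij = addEdge G i j i≢j

  open Consequences G+ij (Contains G+ij J4)

  inclusion : Embedding E G+ij
  inclusion = record
    { place     = id
    ; injective = id
    ; edges     = All.tabulate λ {(x , y)} xy∈ →
        cong (_∨ isPair i j x y) (dec-true (joins? E x y) (inj₁ xy∈))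
    }

  ij : Edge G+ij i j
  ij = trans (cong (adj G i j ∨_) (isPair-self i j)) (Bool.∨-zeroʳ (adj G i j))

  forced : ∀ {x y} → x <ᶠ y → ¬ Joins E x y → Edge G+ij x y → Contains G+ij J4
  forced x<y ¬xy = covered⇒goal {E = E} (J4-embedding {G = G+ij} ∷ []) covered inclusion
    (∈-nonEdges E x<y ¬xy)

  by-order : Tri (i <ᶠ j) (i ≡ j) (j <ᶠ i) → Contains G+ij J4
  by-order (tri< i<j _ _) = forced i<j (¬ij ∘ dec-true (joins? E i j)) ij
  by-order (tri≈ _ i≡j _) = contradiction i≡j i≢j
  by-order (tri> _ _ j<i) = forced j<i (¬ij ∘ dec-true (joins? E i j) ∘ Sum.swap) (Edge-sym G+ij {i} {j} ij)

G₃-maximal : MaximalFree J4 G₃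
G₃-maximal = G₃-free , covered⇒saturated G₃-edges G₃-loopless G₃-covered

addEdge⊆⇒¬MaximalFree : {G K : Graph n} (i j : Fin n) (i≢j : i ≢ j) → ¬ Edge G i j →
  addEdge G i j i≢j ⊆ᴳ K → Free J4 K → ¬ MaximalFree J4 G
addEdge⊆⇒¬MaximalFree {G = G} {K} i j i≢j ¬ij ⊆K free (_ , saturated) =
  Free-mono {G = addEdge G i j i≢j} {K} {J4} (⊆ᴳ⇒Contains {G = addEdge G i j i≢j} {K} ⊆K) free
    (saturated i j i≢j ¬ij)

¬G₁-maximal : ¬ MaximalFree J4 G₁
¬G₁-maximal = addEdge⊆⇒¬MaximalFree {G = G₁} {G₃} (# 0) (# 2) (λ ()) (λ ())
  (from-yes (addEdge G₁ (# 0) (# 2) (λ ()) ⊆ᴳ? G₃)) G₃-free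

¬G₂-maximal : ¬ MaximalFree J4 G₂
¬G₂-maximal = addEdge⊆⇒¬MaximalFree {G = G₂} {G₃} (# 1) (# 3) (λ ()) (λ ())
  (from-yes (addEdge G₂ (# 1) (# 3) (λ ()) ⊆ᴳ? G₃)) G₃-free

-- Minimality

⊆removeEdge⇒¬MinimalArrows : {G K : Graph n} (i j : Fin n) → Edge G i j → K ⊆ᴳ removeEdge G i j →
  Arrows K two-two-two → ¬ MinimalArrows G two-two-two
⊆removeEdge⇒¬MinimalArrows {G = G} {K} i j ij K⊆ arrows (_ , critical) =
  critical i j ij (Arrows-mono {G = K} {removeEdge G i j}
    (⊆ᴳ⇒Contains {G = K} {removeEdge G i j} K⊆) arrows)

¬G₂-minimal : ¬ MinimalArrows G₂ two-two-two
¬G₂-minimal = ⊆removeEdge⇒¬MinimalArrows {G = G₂} {G₁} (# 0) (# 2) refl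
  (from-yes (G₁ ⊆ᴳ? removeEdge G₂ (# 0) (# 2))) G₁-arrows

¬G₃-minimal : ¬ MinimalArrows G₃ two-two-two
¬G₃-minimal = ⊆removeEdge⇒¬MinimalArrows {G = G₃} {G₁} (# 0) (# 2) refl
  (from-yes (G₁ ⊆ᴳ? removeEdge G₃ (# 0) (# 2))) G₁-arrows

-- The colouring `c` becomes proper once `ij` is deleted, so it witnesses that `ij` is critical.
OnlyMono : Pattern n → Fin n × Fin n → Vec (Fin r) n → Set
OnlyMono E ij c = All (λ (x , y) → lookup c x ≡ lookup c y → (x , y) ≡ ij) E

onlyMono? : (E : Pattern n) (ij : Fin n × Fin n) (c : Vec (Fin r) n) → Dec (OnlyMono E ij c)
onlyMono? E ij c = All.all? (λ (x , y) → lookup c x ≟ lookup c y →-dec ≡-dec _≟_ _≟_ (x , y) ij) E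

-- One colouring for each edge, in the order of `G₁-edges`.
G₁-colourings : List (Vec (Fin 3) 9)
G₁-colourings = map (digits 3 9) (
    000112120 ∷ 011002021 ∷ 010120201 ∷ 010112120 ∷ 010221210 ∷ 010011220 ∷ 011011220 ∷ 010122001
    ∷ 010111220 ∷ 010211220 ∷ 011021220 ∷ 011221002 ∷ 010112220 ∷ 010221201 ∷ 010211202
    ∷ 010211200 ∷ [])

G₁-critical : Pointwise (OnlyMono G₁-edges) G₁-edges G₁-colourings
G₁-critical = from-yes (pointwise? (onlyMono? G₁-edges) G₁-edges G₁-colourings)

colouring-for : {E F : Pattern n} {cs : List (Vec (Fin r) n)} →
  Pointwise (OnlyMono E) F cs → ∀ {ij} → ij ∈ F → Σ (Vec (Fin r) n) (OnlyMono E ij)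
colouring-for {cs = c ∷ _} (only ∷ _) (here refl) = c , only
colouring-for {E = E} (_ ∷ onlys) (there ij∈) = colouring-for {E = E} onlys ij∈

-- A monochromatic edge of the smaller graph would have to be the deleted one. The pair `a`, `b` is
-- allowed both orientations because criticality quantifies over ordered pairs, while `E` lists an
-- edge in one of them.
onlyMono⇒¬Arrows : (E : Pattern n) (loopless : Loopless E) {c : Vec (Fin 3) n} {i j : Fin n} →
  OnlyMono E (i , j) c → ∀ a b → Joins ((i , j) ∷ []) a b →
  ¬ Arrows (removeEdge (graph E loopless) a b) two-two-two
onlyMono⇒¬Arrows E loopless {c} only a b ab arrows =
  case Arrows⇒MonoEdge (removeEdge (graph E loopless) a b) arrows (lookup c) of λ (x , y , xy , same) →
    let kept = Bool.∧-conicalʳ (does (joins? E x y)) _ xy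
        xy∈  = Edge⇒Joins E loopless {x} {y} (Bool.∧-conicalˡ (does (joins? E x y)) _ xy)
    in case trans (≡-sym (cong not (removed x y same ab xy∈))) kept of λ ()
  where
  removed : ∀ x y → lookup c x ≡ lookup c y → Joins _ a b → Joins E x y → isPair a b x y ≡ true
  removed x y same ab (inj₁ xy) with All.lookup only xy same
  removed x y same (inj₁ (here refl)) (inj₁ xy) | refl = isPair-self x y
  removed x y same (inj₂ (here refl)) (inj₁ xy) | refl = trans (isPair-sym y x x y) (isPair-self y x)
  removed x y same ab (inj₂ yx) with All.lookup only yx (≡-sym same)
  removed x y same (inj₁ (here refl)) (inj₂ yx) | refl = trans (isPair-sym y x x y) (isPair-self y x)
  removed x y same (inj₂ (here refl)) (inj₂ yx) | refl = isPair-self x y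

G₁-minimal : MinimalArrows G₁ two-two-two
G₁-minimal = G₁-arrows , λ i j ij → case Edge⇒Joins G₁-edges G₁-loopless {i} {j} ij of λ where
  (inj₁ ij∈) → let c , only = colouring-for {E = G₁-edges} G₁-critical ij∈ in
    onlyMono⇒¬Arrows G₁-edges G₁-loopless {c} only i j (inj₁ (here refl))
  (inj₂ ji∈) → let c , only = colouring-for {E = G₁-edges} G₁-critical ji∈ in
    onlyMono⇒¬Arrows G₁-edges G₁-loopless {c} only i j (inj₂ (here refl))

-- Fewer than nine vertices

isolate : Graph n → Graph (suc n)
isolate G = record
  { adj    = λ { zero _ → false ; (suc _) zero → false ; (suc x) (suc y) → adj G x y }
  ; sym    = λ { zero zero → refl ; zero (suc _) → refl ; (suc _) zero → refl
             ; (suc x) (suc y) → sym G x y }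
  ; irrefl = λ { zero → refl ; (suc x) → irrefl G x }
  }

NoIsolated : Graph n → Set
NoIsolated G = ∀ x → ∃[ y ] Edge G x y

noIsolated? : (G : Graph n) → Dec (NoIsolated G)
noIsolated? G = all? λ x → any? λ y → adj G x y Bool.≟ true

-- A vertex with a neighbour cannot be sent to the isolated vertex `zero`, so all images are
-- successors and the copy already lies in `G`.
Contains-isolate : {G : Graph n} {H : Graph m} → NoIsolated H → Contains (isolate G) H → Contains G H
Contains-isolate {n} {G = G} {H} noIsolated (f , f-inj , f-hom) =
  proj₁ ∘ shift
  , (λ {x} {y} eq → f-inj (trans (proj₂ (shift x)) (trans (cong suc eq) (≡-sym (proj₂ (shift y))))))
  , λ x y xy → subst₂ (Edge (isolate G)) (proj₂ (shift x)) (proj₂ (shift y)) (f-hom x y xy)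
  where
  shift : ∀ x → ∃[ u ] f x ≡ suc u
  shift x with f x | f-hom x (proj₁ (noIsolated x)) (proj₂ (noIsolated x))
  ... | suc u | _ = u , refl
  ... | zero  | ()

InF-isolate : {G : Graph n} → InF two-two-two J4 G → InF two-two-two J4 (isolate G)
InF-isolate {G = G} (free , arrows) =
  free ∘ Contains-isolate {G = G} {J4} (from-yes (noIsolated? J4)) ,
  Arrows-mono {G = G} {isolate G} (suc , suc-injective , λ x y xy → xy) arrows

pad : n ≤′ m → {G : Graph n} → InF two-two-two J4 G → ∃[ H ] InF {m} two-two-two J4 H
pad ≤′-refl     {G} inF = G , inF
pad (≤′-step n≤) {G} inF = let H , inF′ = pad n≤ {G} inF in isolate H , InF-isolate {G = H} inF′

-- The image of the isolated vertex has a neighbour, whose preimage would be a neighbour of `zero`.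
isolate≇ : {G : Graph n} {H : Graph m} → NoIsolated H → ¬ Iso (isolate G) H
isolate≇ {G = G} {H} noIsolated (φ , eq) =
  let y , φ0y = noIsolated (Inverse.to φ zero) in
  case trans (eq zero (Inverse.from φ y)) (trans
    (cong (adj H (Inverse.to φ zero)) (Inverse.strictlyInverseˡ φ y)) φ0y) of λ ()

no-smaller : ∀ n → n < 9 → (G : Graph n) → ¬ InF two-two-two J4 G
no-smaller n n<9 G inF =
  -- Padding stops at eight vertices, so that the ninth is visibly added by `isolate`.
  let H , inF′ = pad (ℕ.≤⇒≤′ (s≤s⁻¹ n<9)) {G} inF in
  case classification (isolate H) (InF-isolate {G = H} inF′) of λ where
    (inj₁ iso)        → isolate≇ {G = H} {G₁} (from-yes (noIsolated? G₁)) iso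
    (inj₂ (inj₁ iso)) → isolate≇ {G = H} {G₂} (from-yes (noIsolated? G₂)) iso
    (inj₂ (inj₂ iso)) → isolate≇ {G = H} {G₃} (from-yes (noIsolated? G₃)) iso

-- Uniqueness of the maximal and the minimal graph

maximal⇒Iso-G₃ : (G : Graph 9) → InF two-two-two J4 G → MaximalFree J4 G → Iso G G₃
maximal⇒Iso-G₃ G inF maximal = case classification G inF of λ where
  (inj₁ iso)        → contradiction (MaximalFree-Iso {G = G₁} {G} {J4} (Iso-sym {G = G} {G₁} iso) maximal) ¬G₁-maximal
  (inj₂ (inj₁ iso)) → contradiction (MaximalFree-Iso {G = G₂} {G} {J4} (Iso-sym {G = G} {G₂} iso) maximal) ¬G₂-maximal
  (inj₂ (inj₂ iso)) → iso

minimal⇒Iso-G₁ : (G : Graph 9) → InF two-two-two J4 G → MinimalArrows G two-two-two → Iso G G₁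
minimal⇒Iso-G₁ G inF minimal = case classification G inF of λ where
  (inj₁ iso)        → iso
  (inj₂ (inj₁ iso)) → contradiction (MinimalArrows-Iso {G = G₂} {G} (Iso-sym {G = G} {G₂} iso) minimal) ¬G₂-minimal
  (inj₂ (inj₂ iso)) → contradiction (MinimalArrows-Iso {G = G₃} {G} (Iso-sym {G = G} {G₃} iso) minimal) ¬G₃-minimal

theorem3 : ((∃[ G ] InF {9} two-two-two J4 G)
    × (∀ n → n < 9 → (G : Graph n) → ¬ InF two-two-two J4 G))
    × (Σ (Graph 9) λ G₁ → Σ (Graph 9) λ G₂ → Σ (Graph 9) λ G₃ →
    InF two-two-two J4 G₁ × InF two-two-two J4 G₂ × InF two-two-two J4 G₃
    × ¬ Iso G₁ G₂ × ¬ Iso G₁ G₃ × ¬ Iso G₂ G₃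
    × (∀ (G : Graph 9) → InF two-two-two J4 G → Iso G G₁ ⊎ (Iso G G₂ ⊎ Iso G G₃)))
    × ((∃[ G ] (InF {9} two-two-two J4 G × MaximalFree J4 G))
    × (∀ (G H : Graph 9) → InF two-two-two J4 G → MaximalFree J4 G
    → InF two-two-two J4 H → MaximalFree J4 H → Iso G H))
    × ((∃[ G ] (InF {9} two-two-two J4 G × MinimalArrows G two-two-two))
    × (∀ (G H : Graph 9) → InF two-two-two J4 G → MinimalArrows G two-two-two
    → InF two-two-two J4 H → MinimalArrows H two-two-two → Iso G H))
theorem3 =
    ((G₁ , inF₁) , no-smaller)
  , (G₁ , G₂ , G₃ , inF₁ , inF₂ , inF₃
    , (λ iso → ¬G₂-minimal (MinimalArrows-Iso {G = G₂} {G₁} (Iso-sym {G = G₁} {G₂} iso) G₁-minimal))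
    , (λ iso → ¬G₃-minimal (MinimalArrows-Iso {G = G₃} {G₁} (Iso-sym {G = G₁} {G₃} iso) G₁-minimal))
    , (λ iso → ¬G₂-maximal (MaximalFree-Iso {G = G₂} {G₃} {J4} iso G₃-maximal))
    , classification)
  , ((G₃ , inF₃ , G₃-maximal)
    , λ G H G∈F G-max H∈F H-max → Iso-trans {G = G} {G₃} {H} (maximal⇒Iso-G₃ G G∈F G-max)
        (Iso-sym {G = H} {G₃} (maximal⇒Iso-G₃ H H∈F H-max)))
  , ((G₁ , inF₁ , G₁-minimal)
    , λ G H G∈F G-min H∈F H-min → Iso-trans {G = G} {G₁} {H} (minimal⇒Iso-G₁ G G∈F G-min)
        (Iso-sym {G = H} {G₁} (minimal⇒Iso-G₁ H H∈F H-min)))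
  where
  inF₁ : InF two-two-two J4 G₁
  inF₁ = G₁-free , G₁-arrows
  inF₂ : InF two-two-two J4 G₂
  inF₂ = G₂-free , G₂-arrows
  inF₃ : InF two-two-two J4 G₃
  inF₃ = G₃-free , G₃-arrows
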